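{- Let $L=p_1^{\alpha_1}p_2^{\alpha_2}\cdots p_{r-1}^{\alpha_{r-1}}p_r^{\alpha_r}\in\mathcal{L}$, where $r>1$, $2=p_1<p_2<\cdots<p_r$ are the primes and $\alpha_1,\dots,\alpha_r$ the exponents occurring in the definition of $\mathcal{L}$ (so that $\alpha_r=1$). Let $M$ be a minimal set of moduli with $\operatorname{lcm}(M)=L$. Let $\Gamma_M$ be the set of all coverings having $M$ as set of moduli, and let $C\in\Gamma_M$. Put $$C_{p_r}=\{(x,m)\in C: p_r\,\|\,m\},\qquad C_{p_{r-1}^{\alpha_{r-1}}}=\{(x,m)\in C: p_{r-1}^{\alpha_{r-1}}\,\|\,m \text{ and } p_r\nmid m\},$$ $$Q=\{(x,m)\in C_{p_r}: p_{r-1}^{\alpha_{r-1}}\nmid m\}.$$ Then $$|\Gamma_M|=\frac{\left(|C_{p_r}|-|Q|\right)!}{\left(p_{r-1}-\left|C_{p_{r-1}^{\alpha_{r-1}}}\right|\right)!\,\left(p_r-|Q|\right)!}\prod_{i=1}^{r}(p_i!)^{\alpha_i}.$$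
   Context: A covering is a finite collection $C=\{(x_i,m_i)\}_{i\in I}$ of congruences $z\equiv x_i\pmod{m_i}$, with integers $x_i\ge 0$, $m_i\ge 2$ and with pairwise distinct moduli $m_i$, such that every integer satisfies at least one of the congruences. The set of moduli of $C$ is $M=\{m_i: i\in I\}$, and $\operatorname{lcm}(M)$ is the least common multiple of its elements. Residues are taken modulo the corresponding modulus (i.e. $0\le x_i<m_i$), so two coverings with the same moduli are equal iff the residue class attached to each modulus is the same. For a finite set $M$ of integers $\ge 2$, $\Gamma_M$ is the set of all coverings whose set of moduli is exactly $M$. A covering is minimal if no proper subset of it is a covering. A set $M$ with $\Gamma_M\neq\emptyset$ is minimal if every $C\in\Gamma_M$ is minimal. The notation $p^t\,\|\,m$ means $p^t\mid m$ and $p^{t+1}\nmid m$. The cardinalities $|C_{p_r}|$, $|C_{p_{r-1}^{\alpha_{r-1}}}|$ and $|Q|$ depend only on $M$, not on the choice of $C\in\Gamma_M$. A positive integer $N$ is a covering number if there is a covering with distinct moduli all of which are divisors of $N$ greater than $1$; it is a primitive covering number if in addition no proper divisor of $N$ is a covering number. The set $\mathcal{L}$ consists of all integers of the form $p_1^{\alpha_1}\cdots p_r^{\alpha_r}$ where $r>1$, $2=p_1<p_2<\cdots<p_r$ are primes with $p_{t+1}\equiv 1\pmod{p_t-1}$ for all $0<t<r-1$ and $p_r\ge (p_{r-1}-2)(p_{r-1}-3)$, and $$\alpha_t=\frac{p_{t+1}-1}{p_t-1}-1\ \ (1\le t\le r-2),\qquad \alpha_{r-1}=\left\lfloor\frac{p_r-1}{p_{r-1}-1}\right\rfloor,\qquad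 \alpha_r=1.$$ (By a theorem of Z.-W. Sun, all elements of $\mathcal{L}$ are primitive covering numbers.) -}

module Defs where

open import Data.Fin.Base using (Fin; zero; suc; inject₁; fromℕ)
open import Data.Integer.Base using (ℤ; +_; _-_)
import Data.Integer.Divisibility as ℤ
open import Data.List.Base using (List; map; foldr; length)
open import Data.List.Membership.Propositional using (_∈_)
open import Data.List.Relation.Binary.Subset.Propositional using (_⊆_)
open import Data.List.Relation.Unary.All using (All)
open import Data.List.Relation.Unary.Any using (Any)
open import Data.List.Relation.Unary.Linked using (Linked)
open import Data.List.Relation.Unary.Unique.Propositional using (Unique)
open import Data.Nat.Base
open import Data.Nat.Divisibility using (_∣_; _∤_; _∣?_)
open import Data.Nat.DivMod using (_/_)
open import Data.Nat.LCM using (lcm)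
open import Data.Nat.Primality using (Prime; prime⇒nonTrivial)
open import Data.Product.Base using (_×_; _,_; proj₁; proj₂; ∃; ∃-syntax)
import Data.Vec.Functional as Vector
open import Function.Bundles using (_⇔_)
open import Relation.Binary.PropositionalEquality.Core using (_≡_; _≢_)
open import Relation.Nullary.Decidable.Core using (Dec; _×-dec_; ¬?)
open import Relation.Nullary.Negation.Core using (¬_)

∏ : ∀ {n} → (Fin n → ℕ) → ℕ
∏ = Vector.foldr _*_ 1

lcms : List ℕ → ℕ
lcms = foldr lcm 1

infix 4 _^_∥_

_^_∥_ : ℕ → ℕ → ℕ → Set
p ^ t ∥ m = (p ^ t) ∣ m × (p ^ suc t) ∤ m

exactPower? : ∀ p t m → Dec (p ^ t ∥ m)
exactPower? p t m = ((p ^ t) ∣? m) ×-dec ¬? ((p ^ suc t) ∣? m)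

HasCardinality : {A : Set} → (A → Set) → ℕ → Set
HasCardinality {A} P n =
  ∃[ xs ] Unique xs × (∀ (x : A) → x ∈ xs ⇔ P x) × length xs ≡ n

-- The pair (x , m) stands for the congruence z ≡ x (mod m).
Congruence : Set
Congruence = ℕ × ℕ

residue modulus : Congruence → ℕ
residue = proj₁
modulus = proj₂

_Satisfies_ : ℤ → Congruence → Set
z Satisfies (x , m) = (+ m) ℤ.∣ (z - + x)

-- A finite set of congruences with distinct moduli is represented by the list
-- of its elements in strictly increasing order of modulus.  Together with the
-- normalisation of residues this makes the representation unique, so _≡_ on
-- lists is equality of coverings.
record IsCovering (C : List Congruence) : Set where
  field
    increasing : Linked _<_ (map modulus C)
    moduli≥2   : All (λ c → 2 ≤ modulus c) C
    normalised : All (λ c → residue c < modulus c) C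
    covers     : ∀ (z : ℤ) → Any (z Satisfies_) C

IsMinimalCovering : List Congruence → Set
IsMinimalCovering C =
  IsCovering C × (∀ D → D ⊆ C → D ≢ C → ¬ IsCovering D)

-- Finite sets of moduli are likewise strictly increasing lists; Γ M is empty
-- for every list M that is not strictly increasing with entries ≥ 2.
Γ : List ℕ → List Congruence → Set
Γ M C = IsCovering C × map modulus C ≡ M

IsMinimalModuli : List ℕ → Set
IsMinimalModuli M = ∃ (Γ M) × (∀ C → Γ M C → IsMinimalCovering C)

prime⇒nonZero-pred : ∀ {p} → Prime p → NonZero (p ∸ 1)
prime⇒nonZero-pred {suc (suc _)} _  = _
prime⇒nonZero-pred {suc zero}    pr with () ← prime⇒nonTrivial pr
prime⇒nonZero-pred {zero}        pr with () ← prime⇒nonTrivial pr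

-- Here r = 2 + k, and the prime p_{i+1} and its exponent α_{i+1} are p i and
-- α i.  As t ranges over Fin k, the indices inject₁ (inject₁ t) and
-- inject₁ (suc t) are those of p_{t+1} and p_{t+2}, never reaching p_r.
record 𝓛 (L : ℕ) : Set where
  field
    k : ℕ
    p : Fin (2 + k) → ℕ
    α : Fin (2 + k) → ℕ

  penult : Fin (2 + k)
  penult = inject₁ (fromℕ k)

  pᵣ : ℕ
  pᵣ = p (fromℕ (suc k))

  pᵣ₋₁ : ℕ
  pᵣ₋₁ = p penult

  αᵣ₋₁ : ℕ
  αᵣ₋₁ = α penult

  field
    p-prime      : ∀ i → Prime (p i)
    p-first      : p zero ≡ 2
    p-increasing : ∀ (i : Fin (suc k)) → p (inject₁ i) < p (suc i)
    p-step       : ∀ (t : Fin k) →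
                   (p (inject₁ (inject₁ t)) ∸ 1) ∣ (p (inject₁ (suc t)) ∸ 1)
    p-last       : pᵣ ≥ (pᵣ₋₁ ∸ 2) * (pᵣ₋₁ ∸ 3)

  _/pred-p_ : ℕ → Fin (2 + k) → ℕ
  n /pred-p i = (n / (p i ∸ 1)) {{prime⇒nonZero-pred (p-prime i)}}

  field
    α-init   : ∀ (t : Fin k) →
               α (inject₁ (inject₁ t)) ≡
               ((p (inject₁ (suc t)) ∸ 1) /pred-p inject₁ (inject₁ t)) ∸ 1
    α-penult : αᵣ₋₁ ≡ (pᵣ ∸ 1) /pred-p penult
    α-last   : α (fromℕ (suc k)) ≡ 1
    L≡∏      : L ≡ ∏ (λ i → p i ^ α i)

{-# OPTIONS --safe #-}

-- Let n = p₁^α₁ ⋯ p_{r−2}^α_{r−2} p_{r−1}^(α_{r−1} − 1), and write p, P for p_{r−1}, p_r.  Building up L / P one prime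
-- factor a at a time, from m to m a, there are at most a − 1 moduli dividing m a but not m, and each of them meets at most
-- one of the a classes mod m a above a class mod m; so every uncovered class (a hole) mod m leaves a hole mod m a.
-- Every hole mod L / P must be filled by P moduli divisible by P.  Two distinct holes share only the moduli P d with
-- d dividing their difference, and counting divisors then shows that two holes can only differ in the last digit
-- to base p (for α_{r−1} = 1 this uses the lower bound on p_r).  Hence there is exactly one hole mod n, and below n each layer consists of exactly a − 1 moduli covering
-- distinct classes above the hole, which gives a factor a ! per layer.
-- Above n, minimality gives every congruence a private point: the moduli dividing n p take distinct residues mod p,
-- those dividing n P (the set Q) distinct residues mod P, and the remaining moduli fill the remaining cells mod n p P
-- bijectively.
module Submission where

open import Defs
open import Data.Empty using (⊥; ⊥-elim)
open import Data.Fin.Base using (Fin; zero; suc; inject₁; fromℕ)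
open import Data.Integer.Base as ℤ using (ℤ; +_)
import Data.Integer.DivMod as ℤ
import Data.Integer.Divisibility as ℤ
import Data.Integer.Divisibility.Signed as Signed
import Data.Integer.Properties as ℤ
open import Data.Integer.Tactic.RingSolver using (solve-∀)
open import Data.List.Base using (List; []; _∷_; _++_; filter; length; map; upTo; cartesianProductWith)
open import Data.List.Membership.Propositional using (_∈_; _∉_; find)
open import Data.List.Membership.Propositional.Properties
open import Data.List.Properties
  using (length-map; length-++; length-upTo; map-++; filter-all; length-filter; filter-notAll; ∷-injective; ∷-injectiveˡ; ∷-injectiveʳ)
open import Data.List.Relation.Binary.Permutation.Propositional using (_↭_; ↭⇒↭ₛ; ↭-sym; ↭-trans; ↭-refl; prep)
open import Data.List.Relation.Binary.Permutation.Propositional.Properties using (∈-resp-↭; shift; ↭-map-inv; ↭-length; All-resp-↭; ++⁺ʳ)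
import Data.List.Relation.Binary.Permutation.Setoid.Properties as Permutation
open import Data.List.Relation.Unary.All as All using (All; []; _∷_)
import Data.List.Relation.Unary.All.Properties as All
open import Data.List.Relation.Unary.AllPairs as AllPairs using (AllPairs; []; _∷_)
import Data.List.Relation.Unary.AllPairs.Properties as AllPairs
open import Data.List.Relation.Unary.Any as Any using (Any; here; there; any?)
import Data.List.Relation.Unary.Any.Properties as Any
open import Data.List.Relation.Unary.Linked using (Linked)
import Data.List.Relation.Unary.Linked.Properties as Linked
open import Data.List.Relation.Unary.Unique.Propositional using (Unique)
import Data.List.Relation.Unary.Unique.Propositional.Properties as Unique
open import Data.Nat.Base
open import Data.Nat.Coprimality as Coprime using (Coprime)
open import Data.Nat.DivMod using (_/_; m/n*n≤m; m*n/n≡m; m≥n⇒m/n>0)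
open import Data.Nat.Divisibility
open import Data.Nat.GCD using (gcd-greatest; c*gcd[m,n]≡gcd[cm,cn]; module Bézout)
open import Data.Nat.LCM using (m∣lcm[m,n]; n∣lcm[m,n])
open import Data.Nat.Primality
import Data.Nat.Properties as ℕ
open import Data.Nat.Tactic.RingSolver using () renaming (solve-∀ to ℕ-solve-∀)
open import Data.Product.Base using (_×_; _,_; proj₁; proj₂; ∃; ∃-syntax)
open import Data.Product.Properties using (≡-dec)
open import Data.Sum.Base using (inj₁; inj₂; [_,_]′)
open import Data.Unit.Base using (⊤; tt)
open import Function.Base using (_∘_; id; it)
open import Function.Bundles using (mk⇔; Equivalence)
open import Relation.Binary.PropositionalEquality
open import Relation.Nullary.Decidable using (decidable-stable)
open import Relation.Nullary.Decidable.Core using (yes; no; _×-dec_; ¬?)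
open import Relation.Nullary.Negation.Core using (¬_; contradiction)
open import Relation.Unary using (Decidable)

-- The exponents in `𝓛` enter through divisor counts. If A collects the prime powers before a, then
-- the relation (α_t + 1)(p_t - 1) = p_{t+1} - 1 makes the number of divisors of A telescope to a -
-- 1. A modulus dividing A a^(j+1) but not A a^j is a^(j+1) d with d dividing A, so each layer is
-- exactly one modulus short of what could cover a class, whatever j is. At P this balance is upset:
-- the floor gives α (p - 1) < P ≤ (α + 1)(p - 1), so the moduli divisible by P can close a hole,
-- possibly with some to spare. Uniqueness of the hole is therefore not a matter of one layer; it
-- comes from comparing the 2 P cells above two holes with the supply of moduli. In the count, the
-- moduli of each part meet at most one cell of the region left to that part. Private points then
-- amount to distinct cells, and the number of choices is a falling factorial that depends only on
-- how many moduli the part has. Minimality, applied to every member of `Γ M`, is what supplies the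
-- private points.

private variable
  a b m n t A W : ℕ
  X Y : Set

-- Divisibility and congruences of integers

∤⇒coprime : Prime a → ¬ a ∣ t → Coprime a t
∤⇒coprime a-prime a∤t (d∣a , d∣t) with prime⇒irreducible a-prime d∣a
... | inj₁ d≡1 = d≡1
... | inj₂ refl = contradiction d∣t a∤t

-- `m` divides the gcd of `n * a` and `n * t`, which is `n` times the gcd of `a` and `t`.
∣*-coprime : Coprime a t → m ∣ n * a → m ∣ n * t → m ∣ n
∣*-coprime {a} {t} {m} {n} a⊥t m∣na m∣nt = subst (m ∣_)
  (trans (sym (c*gcd[m,n]≡gcd[cm,cn] n a t))
         (trans (cong (n *_) (Coprime.coprime⇒gcd≡1 a⊥t)) (ℕ.*-identityʳ n)))
  (gcd-greatest m∣na m∣nt)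

coprime-*-∣ : Coprime a b → a ∣ t → b ∣ t → a * b ∣ t
coprime-*-∣ {a} {b} a⊥b a∣t (divides s refl) =
  subst (a * b ∣_) (ℕ.*-comm b s) (subst (_∣ b * s) (ℕ.*-comm b a)
    (*-monoʳ-∣ b (Coprime.coprime-divisor a⊥b (subst (a ∣_) (ℕ.*-comm s b) a∣t))))

-- A modulus dividing n a but not n distinguishes the a residues mod n a that lie above a residue mod n.
separate-∣ : Prime a → m ∣ n * a → ¬ m ∣ n → n ∣ t → m ∣ t → n * a ∣ t
separate-∣ {a} {m} {n} a-prime m∣na m∤n (divides s refl) m∣t with a ∣? s
... | yes a∣s = subst (n * a ∣_) (ℕ.*-comm n s) (*-monoʳ-∣ n a∣s)
... | no  a∤s = contradiction
  (∣*-coprime (∤⇒coprime a-prime a∤s) m∣na (subst (m ∣_) (ℕ.*-comm s n) m∣t)) m∤n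

-- Write t = s n. If `p` did not divide s, then `m` dividing n P p and n P s would give m ∣ n P;
-- likewise with the primes exchanged. So both primes divide s.
separate₂-∣ : ∀ {p P} → Prime p → Prime P → Coprime p P → m ∣ n * p * P →
  ¬ m ∣ n * p → ¬ m ∣ n * P → n ∣ t → m ∣ t → n * p * P ∣ t
separate₂-∣ {m} {n} {t} {p} {P} p-prime P-prime p⊥P m∣npP m∤np m∤nP (divides s refl) m∣t =
  subst₂ _∣_ (sym (ℕ.*-assoc n p P)) (ℕ.*-comm n s) (*-monoʳ-∣ n (coprime-*-∣ p⊥P p∣s P∣s))
  where
  swap-∣ : m ∣ n * P * p
  swap-∣ = subst (m ∣_) (trans (ℕ.*-assoc n p P) (trans (cong (n *_) (ℕ.*-comm p P)) (sym (ℕ.*-assoc n P p)))) m∣npP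
  m∣nxs : ∀ x → m ∣ n * x * s
  m∣nxs x = subst (m ∣_) (trans (cong (_* x) (ℕ.*-comm s n)) (trans (ℕ.*-assoc n s x)
    (trans (cong (n *_) (ℕ.*-comm s x)) (sym (ℕ.*-assoc n x s))))) (∣m⇒∣m*n x m∣t)
  p∣s : p ∣ s
  p∣s with p ∣? s
  ... | yes d = d
  ... | no  d = contradiction (∣*-coprime (∤⇒coprime p-prime d) swap-∣ (m∣nxs P)) m∤nP
  P∣s : P ∣ s
  P∣s with P ∣? s
  ... | yes d = d
  ... | no  d = contradiction (∣*-coprime (∤⇒coprime P-prime d) m∣npP (m∣nxs p)) m∤np

-- Each factor `a` of the power is either matched with a factor `a` of `m` or, once `a` does not
-- divide `m`, cancelled by coprimality.
∣*^⇒ : ∀ j → Prime a → m ∣ A * a ^ j → ∃[ i ] ∃[ d ] i ≤ j × d ∣ A × m ≡ a ^ i * d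
∣*^⇒ {a} {m} {A} zero a-prime m∣ = 0 , m , z≤n , subst (m ∣_) (ℕ.*-identityʳ A) m∣ , sym (ℕ.*-identityˡ m)
∣*^⇒ {a} {m} {A} (suc j) a-prime m∣ with a ∣? m
... | no  a∤m with i , d , i≤j , d∣A , eq ← ∣*^⇒ {A = A} j a-prime
        (Coprime.coprime-divisor {m = m} {n = a} {o = A * a ^ j} (Coprime.sym (∤⇒coprime a-prime a∤m))
          (subst (m ∣_) (trans (sym (ℕ.*-assoc A a (a ^ j))) (trans (cong (_* a ^ j) (ℕ.*-comm A a)) (ℕ.*-assoc a A (a ^ j)))) m∣))
      = i , d , ℕ.m≤n⇒m≤1+n i≤j , d∣A , eq
... | yes (divides s refl) with i , d , i≤j , d∣A , eq ← ∣*^⇒ {A = A} j a-prime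
        (*-cancelʳ-∣ {m = s} {n = A * a ^ j} a {{prime⇒nonZero a-prime}}
          (subst (s * a ∣_) (trans (cong (A *_) (ℕ.*-comm a (a ^ j))) (sym (ℕ.*-assoc A (a ^ j) a))) m∣))
      = suc i , d , s≤s i≤j , d∣A ,
        trans (cong (_* a) eq) (trans (ℕ.*-comm (a ^ i * d) a) (sym (ℕ.*-assoc a (a ^ i) d)))

^-mono-∣ : ∀ {i j} → i ≤ j → a ^ i ∣ a ^ j
^-mono-∣ {a} {i} {j} i≤j = divides (a ^ (j ∸ i)) (trans (cong (a ^_) (sym (ℕ.m∸n+n≡m i≤j))) (ℕ.^-distribˡ-+-* a (j ∸ i) i))

prime∤* : Prime a → ¬ a ∣ m → ¬ a ∣ n → ¬ a ∣ m * n
prime∤* {m = m} {n} a-prime a∤m a∤n a∣mn with euclidsLemma m n a-prime a∣mn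
... | inj₁ a∣m = a∤m a∣m
... | inj₂ a∣n = a∤n a∣n

prime∤^ : ∀ j → Prime a → ¬ a ∣ m → ¬ a ∣ m ^ j
prime∤^ {a} zero a-prime a∤m a∣1 = ¬prime[1] (subst Prime (∣1⇒≡1 a∣1) a-prime)
prime∤^ (suc j) a-prime a∤m = prime∤* a-prime a∤m (prime∤^ j a-prime a∤m)

prime∤prime : Prime a → Prime b → a ≢ b → ¬ a ∣ b
prime∤prime a-prime b-prime a≢b a∣b with prime⇒irreducible b-prime a∣b
... | inj₁ refl = ¬prime[1] a-prime
... | inj₂ a≡b = a≢b a≡b

coprime-^ : ∀ j → Prime a → ¬ a ∣ m → Coprime m (a ^ j)
coprime-^ {a} {m} zero a-prime a∤m (_ , d∣1) = ∣1⇒≡1 d∣1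
coprime-^ {a} {m} (suc j) a-prime a∤m {d} (d∣m , d∣a^) =
  coprime-^ j a-prime a∤m (d∣m , Coprime.coprime-divisor
    (Coprime.sym (∤⇒coprime a-prime (λ a∣d → a∤m (∣-trans a∣d d∣m)))) d∣a^)

infix 4 _≅_[_]

_≅_[_] : ℤ → ℤ → ℕ → Set
y ≅ z [ n ] = + n ℤ.∣ y ℤ.- z

≅-refl : ∀ {y} → y ≅ y [ n ]
≅-refl {n} {y} = subst (+ n ℤ.∣_) (sym (ℤ.+-inverseʳ y)) (n ∣0)

≅-sym : ∀ {y z} → y ≅ z [ n ] → z ≅ y [ n ]
≅-sym {n} {y} {z} = subst (n ∣_) (ℤ.∣i-j∣≡∣j-i∣ y z)

≅-trans : ∀ {x y z} → x ≅ y [ n ] → y ≅ z [ n ] → x ≅ z [ n ]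
≅-trans {n} {x} {y} {z} p q = Signed.∣⇒∣ᵤ (subst (+ n Signed.∣_) (telescope x y z)
  (Signed.∣m∣n⇒∣m+n (Signed.∣ᵤ⇒∣ {+ n} {x ℤ.- y} p) (Signed.∣ᵤ⇒∣ {+ n} {y ℤ.- z} q)))
  where
  telescope : ∀ x y z → (x ℤ.- y) ℤ.+ (y ℤ.- z) ≡ x ℤ.- z
  telescope = solve-∀

≅-weaken : ∀ {y z} → m ∣ n → y ≅ z [ n ] → y ≅ z [ m ]
≅-weaken = ∣-trans

≅-shift : ∀ z k → z ℤ.+ k ℤ.* + n ≅ z [ n ]
≅-shift {n} z k = Signed.∣⇒∣ᵤ (Signed.divides k (cancel z (k ℤ.* + n)))
  where
  cancel : ∀ z w → z ℤ.+ w ℤ.- z ≡ w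
  cancel = solve-∀

≅⇒shift : ∀ {y z} → y ≅ z [ n ] → ∃[ k ] y ≡ z ℤ.+ k ℤ.* + n
≅⇒shift {n} {y} {z} y≅z with Signed.divides k eq ← Signed.∣ᵤ⇒∣ {+ n} {y ℤ.- z} y≅z =
  k , trans (add-back y z) (cong (λ w → z ℤ.+ w) eq)
  where
  add-back : ∀ y z → y ≡ z ℤ.+ (y ℤ.- z)
  add-back = solve-∀

≅-separate : ∀ {y z} → Prime a → m ∣ n * a → ¬ m ∣ n → y ≅ z [ n ] → y ≅ z [ m ] → y ≅ z [ n * a ]
≅-separate = separate-∣

-- With y = w + k n and y′ = w′ + k′ n, the number a (w - w′) equals a (y - y′) - (k - k′) n a, and
-- `m` divides both terms. A modulus that meets two classes mod `n` thus constrains their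
-- difference.
≅-scale : ∀ {w w′ y y′} a → m ∣ n * a → y ≅ w [ n ] → y′ ≅ w′ [ n ] → y ≅ y′ [ m ] → m ∣ a * ℤ.∣ w ℤ.- w′ ∣
≅-scale {m} {n} {w} {w′} {y} {y′} a m∣na y≅w y′≅w′ y≅y′
  with k , refl ← ≅⇒shift {n} {y} y≅w | k′ , refl ← ≅⇒shift {n} {y′} y′≅w′ =
  subst (m ∣_) (ℤ.abs-* (+ a) (w ℤ.- w′)) (Signed.∣⇒∣ᵤ (subst (+ m Signed.∣_) eq
    (Signed.∣m∣n⇒∣m-n (Signed.∣n⇒∣m*n (+ a) (Signed.∣ᵤ⇒∣ {+ m} {(w ℤ.+ k ℤ.* + n) ℤ.- (w′ ℤ.+ k′ ℤ.* + n)} y≅y′))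
      (Signed.∣n⇒∣m*n (k ℤ.- k′) (Signed.∣ᵤ⇒∣ {+ m} {+ (n * a)} m∣na)))))
  where
  identity : ∀ a n k k′ w w′ → a ℤ.* ((w ℤ.+ k ℤ.* n) ℤ.- (w′ ℤ.+ k′ ℤ.* n)) ℤ.- (k ℤ.- k′) ℤ.* (n ℤ.* a) ≡ a ℤ.* (w ℤ.- w′)
  identity = solve-∀
  eq : + a ℤ.* ((w ℤ.+ k ℤ.* + n) ℤ.- (w′ ℤ.+ k′ ℤ.* + n)) ℤ.- (k ℤ.- k′) ℤ.* + (n * a) ≡ + a ℤ.* (w ℤ.- w′)
  eq = trans (cong (λ x → + a ℤ.* ((w ℤ.+ k ℤ.* + n) ℤ.- (w′ ℤ.+ k′ ℤ.* + n)) ℤ.- (k ℤ.- k′) ℤ.* x) (ℤ.pos-* n a))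
             (identity (+ a) (+ n) k k′ w w′)

<∣⇒≡0 : ∀ {d n} → d < n → n ∣ d → d ≡ 0
<∣⇒≡0 {zero} _ _ = refl
<∣⇒≡0 {suc d} d<n n∣d = contradiction (∣⇒≤ n∣d) (ℕ.<⇒≱ d<n)

≅⇒≡ : ∀ {i j} → i ≤ j → j < n → + j ≅ + i [ n ] → i ≡ j
≅⇒≡ {n} {i} {j} i≤j j<n j≅i = ℕ.≤-antisym i≤j (ℕ.m∸n≡0⇒m≤n (<∣⇒≡0 (ℕ.≤-<-trans (ℕ.m∸n≤m j i) j<n)
  (subst (n ∣_) (trans (cong ℤ.∣_∣ (ℤ.m-n≡m⊖n j i)) (cong ℤ.∣_∣ (ℤ.⊖-≥ i≤j))) j≅i)))

residue-unique : ∀ {y} (i j n : ℕ) → i < n → j < n → y ≅ + i [ n ] → y ≅ + j [ n ] → i ≡ j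
residue-unique {y} i j n i<n j<n y≅i y≅j with ℕ.≤-total i j
... | inj₁ i≤j = ≅⇒≡ {n} i≤j j<n (≅-trans {n} {+ j} {y} (≅-sym {n} {y} y≅j) y≅i)
... | inj₂ j≤i = sym (≅⇒≡ {n} j≤i i<n (≅-trans {n} {+ i} {y} (≅-sym {n} {y} y≅i) y≅j))

≅-% : ∀ z n .{{_ : NonZero n}} → z ≅ + (z ℤ.%ℕ n) [ n ]
≅-% z n = subst (λ x → x ≅ + (z ℤ.%ℕ n) [ n ]) (sym (ℤ.a≡a%ℕn+[a/ℕn]*n z n)) (≅-shift {n} (+ (z ℤ.%ℕ n)) (z ℤ./ℕ n))

child : ℤ → ℕ → ℕ → ℤ
child z n j = z ℤ.+ + j ℤ.* + n

child-injective : ∀ z .{{_ : NonZero n}} {i j} → i < a → j < a → child z n i ≅ child z n j [ n * a ] → i ≡ j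
child-injective {n} {a} z {i} {j} i<a j<a ≅ =
  residue-unique {+ i} i j a i<a j<a (≅-refl {a} {+ i})
    (*-cancelˡ-∣ n (subst (n * a ∣_) (trans (cong ℤ.∣_∣ (identity z (+ i) (+ j) (+ n))) (ℤ.abs-* (+ n) (+ i ℤ.- + j))) ≅))
  where
  identity : ∀ z i j n → (z ℤ.+ i ℤ.* n) ℤ.- (z ℤ.+ j ℤ.* n) ≡ n ℤ.* (i ℤ.- j)
  identity = solve-∀

child-exists : ∀ {y z} .{{_ : NonZero a}} → y ≅ z [ n ] → ∃[ j ] j < a × y ≅ child z n j [ n * a ]
child-exists {a} {n} {y} {z} y≅z with k , refl ← ≅⇒shift {n} {y} y≅z =
  k ℤ.%ℕ a , ℤ.n%ℕd<d k a , subst (n * a ∣_) (sym eq)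
    (*-monoʳ-∣ n (≅-% k a))
  where
  identity : ∀ z i j n → (z ℤ.+ i ℤ.* n) ℤ.- (z ℤ.+ j ℤ.* n) ≡ n ℤ.* (i ℤ.- j)
  identity = solve-∀
  eq : ℤ.∣ (z ℤ.+ k ℤ.* + n) ℤ.- child z n (k ℤ.%ℕ a) ∣ ≡ n * ℤ.∣ k ℤ.- + (k ℤ.%ℕ a) ∣
  eq = trans (cong ℤ.∣_∣ (identity z k (+ (k ℤ.%ℕ a)) (+ n))) (ℤ.abs-* (+ n) (k ℤ.- + (k ℤ.%ℕ a)))

inverse : ∀ {p P} → Coprime p P → ∃[ u ] u ℤ.* + p ≅ + 1 [ P ]
inverse {p} {P} p⊥P with Coprime.coprime-Bézout p⊥P
... | Bézout.+- x y eq = + x , Signed.∣⇒∣ᵤ (Signed.divides (+ y)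
        (trans (cong (λ w → w ℤ.- + 1) (trans (sym (ℤ.pos-* x p)) (trans (cong (λ w → + w) (sym eq)) (cong (λ w → + 1 ℤ.+ w) (ℤ.pos-* y P)))))
               (identity (+ y ℤ.* + P))))
  where
  identity : ∀ w → + 1 ℤ.+ w ℤ.- + 1 ≡ w
  identity = solve-∀
... | Bézout.-+ x y eq = ℤ.- + x , Signed.∣⇒∣ᵤ (Signed.divides (ℤ.- + y)
        (trans (identity (+ x) (+ p)) (trans (cong (λ w → ℤ.- w) (trans (cong (λ w → + 1 ℤ.+ w) (sym (ℤ.pos-* x p))) (trans (cong (λ w → + w) eq) (ℤ.pos-* y P))))
          (ℤ.neg-distribˡ-* (+ y) (+ P)))))
  where
  identity : ∀ x p → (ℤ.- x) ℤ.* p ℤ.- + 1 ≡ ℤ.- (+ 1 ℤ.+ x ℤ.* p)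
  identity = solve-∀

-- glue u x y lies in the class of x mod n p and of y mod n P, if u inverts p mod P and x ≅ y mod n.
glue : ℕ → ℤ → ℤ → ℤ → ℤ
glue p u x y = x ℤ.+ (y ℤ.- x) ℤ.* (u ℤ.* + p)

glue-left : ∀ {p u x y} → x ≅ y [ n ] → glue p u x y ≅ x [ n * p ]
glue-left {n} {p} {u} {x} {y} x≅y with k , refl ← ≅⇒shift {n} {y} {x} (≅-sym {n} {x} x≅y) =
  subst (λ w → w ≅ x [ n * p ]) (cong (λ w → x ℤ.+ w)
    (trans (cong (λ w → k ℤ.* u ℤ.* w) (ℤ.pos-* n p)) (identity k u (+ n) (+ p) x)))
    (≅-shift {n * p} x (k ℤ.* u))
  where
  identity : ∀ k u n p x → k ℤ.* u ℤ.* (n ℤ.* p) ≡ (x ℤ.+ k ℤ.* n ℤ.- x) ℤ.* (u ℤ.* p)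
  identity = solve-∀

glue-right : ∀ {p P u x y} → u ℤ.* + p ≅ + 1 [ P ] → x ≅ y [ n ] → glue p u x y ≅ y [ n * P ]
glue-right {n} {p} {P} {u} {x} {y} up≅1 x≅y with k , refl ← ≅⇒shift {n} {y} {x} (≅-sym {n} {x} x≅y) =
  subst (n * P ∣_) (sym (trans (cong ℤ.∣_∣ (identity k (u ℤ.* + p) (+ n) x)) (trans (ℤ.abs-* k _)
    (cong (ℤ.∣ k ∣ *_) (ℤ.abs-* (+ n) _)))))
    (∣n⇒∣m*n ℤ.∣ k ∣ (*-monoʳ-∣ n up≅1))
  where
  identity : ∀ k v n x → x ℤ.+ (x ℤ.+ k ℤ.* n ℤ.- x) ℤ.* v ℤ.- (x ℤ.+ k ℤ.* n) ≡ k ℤ.* (n ℤ.* (v ℤ.- + 1))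
  identity = solve-∀

-- Lists and cardinalities

AllPairs-map∈ : {R S : X → X → Set} → ∀ {xs} → (∀ {x y} → x ∈ xs → y ∈ xs → R x y → S x y) →
  AllPairs R xs → AllPairs S xs
AllPairs-map∈ f []       = []
AllPairs-map∈ f (r ∷ rs) =
  All.tabulate (λ y∈ → f (here refl) (there y∈) (All.lookup r y∈)) ∷ AllPairs-map∈ (λ x∈ y∈ → f (there x∈) (there y∈)) rs

length-⊆ : ∀ {xs ys : List X} → Unique xs → (∀ {x} → x ∈ xs → x ∈ ys) → length xs ≤ length ys
length-⊆ {xs = []}     _        _     = z≤n
length-⊆ {xs = x ∷ xs} (x∉ ∷ u) xs⊆ys with as , bs , refl ← ∈-∃++ (xs⊆ys (here refl)) =
  ℕ.≤-trans (s≤s (length-⊆ u smaller)) (ℕ.≤-reflexive (sym (↭-length (shift x as bs))))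
  where
  smaller : ∀ {y} → y ∈ xs → y ∈ as ++ bs
  smaller y∈ with ∈-resp-↭ (shift x as bs) (xs⊆ys (there y∈))
  ... | here refl = contradiction refl (All.lookup x∉ y∈)
  ... | there y∈′ = y∈′

length-cartesianProductWith : {Z : Set} (f : X → Y → Z) → ∀ xs ys → length (cartesianProductWith f xs ys) ≡ length xs * length ys
length-cartesianProductWith f []       ys = refl
length-cartesianProductWith f (x ∷ xs) ys =
  trans (length-++ (map (f x) ys)) (cong₂ _+_ (length-map (f x) ys) (length-cartesianProductWith f xs ys))

module _ {P Q : X → Set} (P? : Decidable P) (Q? : Decidable Q) where

  filter-cong∈ : ∀ {xs} → (∀ {x} → x ∈ xs → P x → Q x) → (∀ {x} → x ∈ xs → Q x → P x) → filter P? xs ≡ filter Q? xs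
  filter-cong∈ {[]}     _ _ = refl
  filter-cong∈ {x ∷ xs} f g with P? x | Q? x
  ... | yes _  | yes _  = cong (x ∷_) (filter-cong∈ (f ∘ there) (g ∘ there))
  ... | yes px | no ¬qx = contradiction (f (here refl) px) ¬qx
  ... | no ¬px | yes qx = contradiction (g (here refl) qx) ¬px
  ... | no _   | no _   = filter-cong∈ (f ∘ there) (g ∘ there)

  length-filter-+ : ∀ xs → length (filter P? xs) + length (filter Q? xs) ≤
    length xs + length (filter (λ x → P? x ×-dec Q? x) xs)
  length-filter-+ []       = z≤n
  length-filter-+ (x ∷ xs) with P? x | Q? x
  ... | yes _ | yes _ = s≤s (ℕ.≤-trans (ℕ.≤-reflexive (ℕ.+-suc _ _))
                          (ℕ.≤-trans (s≤s (length-filter-+ xs)) (ℕ.≤-reflexive (sym (ℕ.+-suc _ _)))))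
  ... | yes _ | no _  = s≤s (length-filter-+ xs)
  ... | no _  | yes _ = ℕ.≤-trans (ℕ.≤-reflexive (ℕ.+-suc _ _)) (s≤s (length-filter-+ xs))
  ... | no _  | no _  = ℕ.m≤n⇒m≤1+n (length-filter-+ xs)

filter-filter : {P Q : X → Set} (P? : Decidable P) (Q? : Decidable Q) → ∀ xs →
  filter Q? (filter P? xs) ≡ filter (λ x → P? x ×-dec Q? x) xs
filter-filter P? Q? []       = refl
filter-filter P? Q? (x ∷ xs) with P? x
... | no _ = filter-filter P? Q? xs
... | yes _ with Q? x
...   | yes _ = cong (x ∷_) (filter-filter P? Q? xs)
...   | no _  = filter-filter P? Q? xs

filter-↭ : {P : X → Set} (P? : Decidable P) → ∀ xs → filter (¬? ∘ P?) xs ++ filter P? xs ↭ xs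
filter-↭ P? []       = ↭-refl
filter-↭ P? (x ∷ xs) with P? x
... | yes _ = ↭-trans (shift x (filter (¬? ∘ P?) xs) (filter P? xs)) (prep x (filter-↭ P? xs))
... | no _  = prep x (filter-↭ P? xs)

map-filter : {P : Y → Set} (P? : Decidable P) (f : X → Y) → ∀ xs → map f (filter (P? ∘ f) xs) ≡ filter P? (map f xs)
map-filter P? f []       = refl
map-filter P? f (x ∷ xs) with P? (f x)
... | yes _ = cong (f x ∷_) (map-filter P? f xs)
... | no _  = map-filter P? f xs

module _ {P : X → Set} (P? : Decidable P) where

  length-filter-¬≥ : {R : X → X → Set} → ∀ {xs} → AllPairs R xs → (∀ {x y} → x ∈ xs → y ∈ xs → R x y → P x → P y → ⊥) →
    length xs ≤ suc (length (filter (¬? ∘ P?) xs))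
  length-filter-¬≥ []       _ = z≤n
  length-filter-¬≥ {xs = x ∷ xs} (r ∷ rs) excl with P? x
  ... | no _   = s≤s (length-filter-¬≥ rs (λ x∈ y∈ → excl (there x∈) (there y∈)))
  ... | yes px = s≤s (ℕ.≤-reflexive (cong length (sym (filter-all (¬? ∘ P?)
                   (All.tabulate (λ y∈ → excl (here refl) (there y∈) (All.lookup r y∈) px))))))

  length-filter-¬< : ∀ {xs} → Any P xs → suc (length (filter (¬? ∘ P?) xs)) ≤ length xs
  length-filter-¬< {x ∷ xs} (here px) with P? x
  ... | yes _  = s≤s (length-filter (¬? ∘ P?) xs)
  ... | no ¬px = contradiction px ¬px
  length-filter-¬< {x ∷ xs} (there p) with P? x
  ... | yes _ = ℕ.m≤n⇒m≤1+n (length-filter-¬< p)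
  ... | no _  = s≤s (length-filter-¬< p)

module _ {P : X → Set} {n : ℕ} where
  open Equivalence

  card-cong : {Q : X → Set} → (∀ {x} → P x → Q x) → (∀ {x} → Q x → P x) → HasCardinality P n → HasCardinality Q n
  card-cong f g (xs , u , ∈⇔ , eq) = xs , u , (λ x → mk⇔ (f ∘ to (∈⇔ x)) (from (∈⇔ x) ∘ g)) , eq

  -- The correspondence is a relation because a covering is tied to its pieces only up to
  -- permutation. Functionality is asked for inside `Q`, where the list of moduli fixes the order.
  card-bijection : {Q : Y → Set} (R : X → Y → Set) →
    (∀ {x} → P x → ∃[ y ] Q y × R x y) →
    (∀ {y} → Q y → ∃[ x ] P x × R x y) →
    (∀ {x x′ y} → P x → P x′ → R x y → R x′ y → x ≡ x′) →
    (∀ {x y y′} → Q y → Q y′ → R x y → R x y′ → y ≡ y′) →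
    HasCardinality P n → HasCardinality Q n
  card-bijection {Y = Y} {Q = Q} R fwd bwd inj fun (xs , u , ∈⇔ , eq) =
    let ys , uys , ys⇒ , ⇒ys , eq′ = image xs u (λ {x} → to (∈⇔ x)) in
    ys , uys , (λ y → mk⇔ (proj₁ ∘ ys⇒) (λ qy → let x , px , rxy = bwd qy in ⇒ys qy (from (∈⇔ x) px) rxy)) , trans eq′ eq
    where
    image : ∀ xs → Unique xs → (∀ {x} → x ∈ xs → P x) →
      ∃[ ys ] Unique ys × (∀ {y} → y ∈ ys → Q y × ∃[ x ] x ∈ xs × R x y) ×
        (∀ {x y} → Q y → x ∈ xs → R x y → y ∈ ys) × length ys ≡ length xs
    image []       _        _   = [] , [] , (λ ()) , (λ _ ()) , refl
    image (x ∷ xs) (x∉ ∷ u) all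
      with y , qy , rxy ← fwd (all (here refl)) | ys , uys , ys⇒ , ⇒ys , eq ← image xs u (all ∘ there) =
      y ∷ ys ,
      All.tabulate (λ { y∈ refl → let _ , x′ , x′∈ , r = ys⇒ y∈ in
        All.lookup x∉ x′∈ (inj (all (here refl)) (all (there x′∈)) rxy r) }) ∷ uys ,
      (λ { (here refl) → qy , x , here refl , rxy
         ; (there y∈) → let q , x′ , x′∈ , r = ys⇒ y∈ in q , x′ , there x′∈ , r }) ,
      (λ { q (here refl) r → here (fun q qy r rxy) ; q (there x∈) r → there (⇒ys q x∈ r) }) ,
      cong suc eq

module _ {P : X → Set} {R : X → Y → Set} {b : ℕ} where
  open Equivalence

  card-× : ∀ {a} → HasCardinality P a → (∀ {x} → P x → HasCardinality (R x) b) →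
    HasCardinality (λ (x , y) → P x × R x y) (a * b)
  card-× (xs , u , ∈⇔ , refl) fibre = let zs , uzs , zs⇒ , ⇒zs , eq = total xs u (λ {x} → to (∈⇔ x)) in
    zs , uzs , (λ (x , y) → mk⇔ (λ z∈ → let x∈ , r = zs⇒ z∈ in to (∈⇔ x) x∈ , r) (λ (px , r) → ⇒zs (from (∈⇔ x) px) r)) , eq
    where
    total : ∀ xs → Unique xs → (∀ {x} → x ∈ xs → P x) →
      ∃[ zs ] Unique zs × (∀ {x y} → (x , y) ∈ zs → x ∈ xs × R x y) ×
        (∀ {x y} → x ∈ xs → R x y → (x , y) ∈ zs) × length zs ≡ length xs * b
    total []       _        _   = [] , [] , (λ ()) , (λ ()) , refl
    total (x ∷ xs) (x∉ ∷ u) all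
      with ys , uys , ys⇔ , refl ← fibre (all (here refl)) | zs , uzs , zs⇒ , ⇒zs , eq ← total xs u (all ∘ there) =
      map (x ,_) ys ++ zs ,
      Unique.++⁺ (Unique.map⁺ (λ { refl → refl }) uys) uzs
        (λ { (v∈ , v∈′) → let _ , _ , eq′ = ∈-map⁻ (x ,_) v∈ in
             All.lookup x∉ (proj₁ (zs⇒ (subst (_∈ zs) eq′ v∈′))) refl }) ,
      (λ z∈ → [ (λ z∈ → let y , y∈ , eq′ = ∈-map⁻ (x ,_) z∈ in
                  here (cong proj₁ eq′) , subst (λ (x , y) → R x y) (sym eq′) (to (ys⇔ y) y∈))
              , (λ z∈ → let x∈ , r = zs⇒ z∈ in there x∈ , r) ]′ (∈-++⁻ (map (x ,_) ys) z∈)) ,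
      (λ { (here refl) r → ∈-++⁺ˡ (∈-map⁺ (x ,_) (from (ys⇔ _) r))
         ; (there x∈) r → ∈-++⁺ʳ (map (x ,_) ys) (⇒zs x∈ r) }) ,
      trans (length-++ (map (x ,_) ys)) (cong₂ _+_ (length-map (x ,_) ys) eq)

-- The falling factorial n (n - 1) ... (n - k + 1): the ways to put `k` labelled congruences into
-- `n` cells without collision.
fall : ℕ → ℕ → ℕ
fall n zero    = 1
fall n (suc k) = fall n k * (n ∸ k)

fall-! : ∀ {n k} → k ≤ n → fall n k * (n ∸ k) ! ≡ n !
fall-! {n} {zero} _ = ℕ.*-identityˡ (n !)
fall-! {n} {suc k} k<n = trans (ℕ.*-assoc (fall n k) (n ∸ k) _) (trans (cong (fall n k *_) step) (fall-! (ℕ.<⇒≤ k<n)))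
  where
  step : (n ∸ k) * (n ∸ suc k) ! ≡ (n ∸ k) !
  step rewrite ℕ.+-∸-assoc 1 k<n = refl

fall-full : ∀ n → fall n n ≡ n !
fall-full n = trans (sym (ℕ.*-identityʳ _)) (trans (cong (λ k → fall n n * k !) (sym (ℕ.n∸n≡0 n))) (fall-! {n} ℕ.≤-refl))

-- The factor left out is 1, so a - 1 congruences can be put on a cells in a ! ways. This is the
-- contribution of one layer.
fall-pred : ∀ n → fall (suc n) n ≡ suc n !
fall-pred n = trans (sym (ℕ.*-identityʳ _)) (trans (cong (λ k → fall (suc n) n * k !) (sym (ℕ.m+n∸n≡m 1 n))) (fall-! {suc n} (ℕ.n≤1+n n)))

Unique-resp-↭ : ∀ {xs ys : List X} → xs ↭ ys → Unique xs → Unique ys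
Unique-resp-↭ xs↭ys = Permutation.Unique-resp-↭ (setoid _) (↭⇒↭ₛ xs↭ys)

-- Cells of a region and the congruences that fit into it

Region : Set₁
Region = ℤ → Set

private variable
  U U′ U₁ U₂ : Region
  C D : List Congruence
  c : Congruence
  zs : List ℤ

Covered : List Congruence → Region
Covered D y = Any (y Satisfies_) D

satisfies? : ∀ c → Decidable (_Satisfies c)
satisfies? (x , m) y = m ∣? ℤ.∣ y ℤ.- + x ∣

covered? : ∀ D → Decidable (Covered D)
covered? D y = any? (λ c → satisfies? c y) D

Satisfies-resp : ∀ c {n y z} → modulus c ∣ n → y ≅ z [ n ] → y Satisfies c → z Satisfies c
Satisfies-resp (x , m) {n} {y} {z} m∣n y≅z y∈c =
  ≅-trans {m} {z} {y} {+ x} (≅-sym {m} {y} {z} (≅-weaken {m} {n} {y} {z} m∣n y≅z)) y∈c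

Satisfies⇒≅ : ∀ c {y z} → y Satisfies c → z Satisfies c → y ≅ z [ modulus c ]
Satisfies⇒≅ (x , m) {y} {z} y∈c z∈c = ≅-trans {m} {y} {+ x} {z} y∈c (≅-sym {m} {z} {+ x} z∈c)

infixl 6 _∖_

_∖_ : Region → List Congruence → Region
(U ∖ D) y = U y × ¬ Covered D y

record Cells (n : ℕ) (U : Region) (zs : List ℤ) : Set where
  field
    complete : ∀ {y} → U y → ∃[ z ] z ∈ zs × y ≅ z [ n ]
    sound    : ∀ {z} → z ∈ zs → U z
    distinct : AllPairs (λ y z → ¬ y ≅ z [ n ]) zs

-- The first half makes a congruence cover every cell that it meets; the second lets it meet at most
-- one cell of `U`.
Separates : ℕ → Region → ℕ → Set
Separates n U m = m ∣ n × (∀ y z → U y → U z → y ≅ z [ m ] → y ≅ z [ n ])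

Separating : ℕ → Region → List Congruence → Set
Separating n U D = ∀ {c} → c ∈ D → Separates n U (modulus c)

-- For separating moduli a private point for each congruence means that different congruences occupy
-- different cells; for the region of all integers it is irredundancy of a covering. The one notion
-- carries minimality into the count.
Fits : Region → List Congruence → Set
Fits U D = ∀ c → c ∈ D → ∃[ y ] U y × y Satisfies c × (∀ c′ → c′ ∈ D → y Satisfies c′ → c′ ≡ c)

survivors : List Congruence → List ℤ → List ℤ
survivors []      zs = zs
survivors (c ∷ D) zs = filter (¬? ∘ satisfies? c) (survivors D zs)

survivors-cells : ∀ D → Cells n U zs → (∀ {c} → c ∈ D → modulus c ∣ n) → Cells n (U ∖ D) (survivors D zs)
survivors-cells [] cells _ = record
  { complete = λ (uy , _) → Cells.complete cells uy
  ; sound    = λ z∈ → Cells.sound cells z∈ , λ ()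
  ; distinct = Cells.distinct cells
  }
survivors-cells {n} {U} (c ∷ D) cells ∣n = record
  { complete = λ { {y} (uy , y∉) →
      let z , z∈ , y≅z = Cells.complete rest (uy , y∉ ∘ there) in
      z , ∈-filter⁺ (¬? ∘ satisfies? c) z∈
            (λ z∈c → y∉ (here (Satisfies-resp c {n} {z} {y} (∣n (here refl)) (≅-sym {n} {y} {z} y≅z) z∈c))) , y≅z }
  ; sound    = λ z∈ → let z∈D , z∉c = ∈-filter⁻ (¬? ∘ satisfies? c) z∈
                          uz , z∉D = Cells.sound rest z∈D in
                      uz , λ { (here z∈c) → z∉c z∈c ; (there z∈) → z∉D z∈ }
  ; distinct = AllPairs.filter⁺ (¬? ∘ satisfies? c) (Cells.distinct rest)
  }
  where
  rest : Cells n (U ∖ D) (survivors D _)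
  rest = survivors-cells D cells (∣n ∘ there)

survivors-⊆ : ∀ D {zs z} → z ∈ survivors D zs → z ∈ zs
survivors-⊆ []      z∈ = z∈
survivors-⊆ (c ∷ D) z∈ = survivors-⊆ D (proj₁ (∈-filter⁻ (¬? ∘ satisfies? c) z∈))

survivors-step≥ : ∀ c → Separates n U (modulus c) → Cells n (U ∖ D) zs →
  length zs ≤ suc (length (filter (¬? ∘ satisfies? c) zs))
survivors-step≥ {n} c (_ , sep) cells = length-filter-¬≥ (satisfies? c) (Cells.distinct cells)
  λ {x} {y} x∈ y∈ x≇y x∈c y∈c →
    x≇y (sep x y (proj₁ (Cells.sound cells x∈)) (proj₁ (Cells.sound cells y∈)) (Satisfies⇒≅ c {x} {y} x∈c y∈c))

length-survivors≥ : ∀ D → Separating n U D → Cells n U zs → length zs ≤ length (survivors D zs) + length D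
length-survivors≥ []      _   _     = ℕ.m≤m+n _ 0
length-survivors≥ {zs = zs} (c ∷ D) sep cells = begin
  length zs                                     ≤⟨ length-survivors≥ D (sep ∘ there) cells ⟩
  length (survivors D zs) + length D            ≤⟨ ℕ.+-monoˡ-≤ (length D) (survivors-step≥ {D = D} c (sep (here refl))
                                                     (survivors-cells D cells (proj₁ ∘ sep ∘ there))) ⟩
  suc (length (survivors (c ∷ D) zs)) + length D ≡⟨ ℕ.+-suc _ (length D) ⟨
  length (survivors (c ∷ D) zs) + length (c ∷ D) ∎
  where open ℕ.≤-Reasoning

fits-tail : Fits U (c ∷ D) → Fits U D
fits-tail fits c c∈ = let y , uy , y∈ , only = fits c (there c∈) in y , uy , y∈ , λ c′ → only c′ ∘ there

-- An earlier private point `y` of `c₁` stays private: if `c` held at `y`, then `y` and `z` would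
-- share a cell, and `c₁` would cover `z`, which `D` leaves free.
fits-cons : Separating n U (c ∷ D) → Fits U D → ∀ {z} → (U ∖ D) z → z Satisfies c → Fits U (c ∷ D)
fits-cons sep fits {z} (uz , z∉D) z∈c _ (here refl) = z , uz , z∈c ,
  λ { _ (here refl) _ → refl
    ; c′ (there c′∈) z∈c′ → contradiction (Any.map (λ { refl → z∈c′ }) c′∈) z∉D }
fits-cons {n} {c = c} sep fits {z} (uz , z∉D) z∈c c₁ (there c₁∈) with y , uy , y∈c₁ , only ← fits c₁ c₁∈ = y , uy , y∈c₁ ,
  λ { _ (here refl) y∈c → contradiction
        (Any.map (λ { refl → Satisfies-resp c₁ {n} {y} {z} (proj₁ (sep (there c₁∈)))
          (proj₂ (sep (here refl)) y z uy uz (Satisfies⇒≅ c {y} {z} y∈c z∈c)) y∈c₁ }) c₁∈) z∉D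
    ; c′ (there c′∈) → only c′ c′∈ }

fits⇒survivor : c ∉ D → Fits U (c ∷ D) → ∃[ y ] (U ∖ D) y × y Satisfies c
fits⇒survivor {c} c∉D fits with y , uy , y∈c , only ← fits c (here refl) = y ,
  (uy , λ y∈D → let c′ , c′∈ , y∈c′ = find y∈D in c∉D (subst (_∈ _) (only c′ (there c′∈) y∈c′) c′∈)) , y∈c

-- The private point of each congruence lies in a cell that the later ones in the list leave free,
-- so every congruence removes at least one cell.
length-survivors≤ : ∀ D → Unique D → Separating n U D → Cells n U zs → Fits U D →
  length (survivors D zs) + length D ≤ length zs
length-survivors≤ [] _ _ _ _ = ℕ.≤-reflexive (ℕ.+-identityʳ _)
length-survivors≤ {n} {U} {zs} (c ∷ D) u@(_ ∷ uD) sep cells fits = begin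
  length (survivors (c ∷ D) zs) + length (c ∷ D)  ≡⟨ ℕ.+-suc _ (length D) ⟩
  suc (length (survivors (c ∷ D) zs)) + length D  ≤⟨ ℕ.+-monoˡ-≤ (length D) (length-filter-¬< (satisfies? c) hit) ⟩
  length (survivors D zs) + length D              ≤⟨ length-survivors≤ D uD (sep ∘ there) cells (fits-tail fits) ⟩
  length zs                                       ∎
  where
  open ℕ.≤-Reasoning
  hit : Any (_Satisfies c) (survivors D zs)
  hit with y , y∈ , y∈c ← fits⇒survivor (Unique.Unique[x∷xs]⇒x∉xs u) fits
      with z , z∈ , y≅z ← Cells.complete (survivors-cells D cells (proj₁ ∘ sep ∘ there)) y∈ =
    Any.map (λ { refl → Satisfies-resp c {n} {y} {z} (proj₁ (sep (here refl))) y≅z y∈c }) z∈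

length-survivors : Unique D → Separating n U D → Cells n U zs → Fits U D →
  length (survivors D zs) + length D ≡ length zs
length-survivors {D} u sep cells fits =
  ℕ.≤-antisym (length-survivors≤ D u sep cells fits) (length-survivors≥ D sep cells)

-- No congruence removes more than one cell, so a loss of `length D` cells forces each to remove
-- one. If `c` missed all survivors of `D`, then `D` alone would have removed more cells than it has
-- members.
length⇒fits : ∀ D → Separating n U D → Cells n U zs → length (survivors D zs) + length D ≤ length zs → Fits U D
length⇒fits [] _ _ _ _ ()
length⇒fits {n} {U} {zs} (c ∷ D) sep cells len =
  let z , z∈ , z∈c = find hit in
  fits-cons {n} sep (length⇒fits D (sep ∘ there) cells shorter) (Cells.sound rest z∈) z∈c
  where
  open ℕ.≤-Reasoning
  rest : Cells n (U ∖ D) (survivors D zs)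
  rest = survivors-cells D cells (proj₁ ∘ sep ∘ there)
  len′ : suc (length (survivors (c ∷ D) zs)) + length D ≤ length zs
  len′ = ℕ.≤-trans (ℕ.≤-reflexive (sym (ℕ.+-suc _ (length D)))) len
  shorter : length (survivors D zs) + length D ≤ length zs
  shorter = ℕ.≤-trans (ℕ.+-monoˡ-≤ (length D) (survivors-step≥ {D = D} c (sep (here refl)) rest)) len′
  hit : Any (_Satisfies c) (survivors D zs)
  hit with any? (satisfies? c) (survivors D zs)
  ... | yes hit  = hit
  ... | no  miss = contradiction (ℕ.≤-trans len′ (length-survivors≥ D (sep ∘ there) cells))
    (ℕ.<⇒≱ (s≤s (ℕ.≤-reflexive (cong (λ zs → length zs + length D)
      (sym (filter-all (¬? ∘ satisfies? c) (All.¬Any⇒All¬ _ miss)))))))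

Normalised : List Congruence → Set
Normalised = All (λ c → residue c < modulus c)

Assignment : Region → List ℕ → List Congruence → Set
Assignment U V D = map modulus D ≡ V × Normalised D × Fits U D

∈-moduli : ∀ {V} → map modulus D ≡ V → c ∈ D → modulus c ∈ V
∈-moduli refl = ∈-map⁺ modulus

-- Once the tail of `V` is assigned, the choices for the head correspond to the free cells: a cell
-- determines its residue mod `m`, and separation makes these residues distinct.
card-assignments : Cells n U zs → ∀ V → Unique V → (∀ {m} → m ∈ V → 0 < m × Separates n U m) →
  HasCardinality (Assignment U V) (fall (length zs) (length V))
card-assignments cells [] _ _ = ([] ∷ []) , ([] ∷ []) ,
  (λ D → mk⇔ (λ { (here refl) → refl , [] , λ _ () }) λ { (eq , _) → here (empty D eq) }) , refl
  where
  empty : ∀ D → map modulus D ≡ [] → D ≡ []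
  empty [] _ = refl
card-assignments {n} {U} {zs} cells (m ∷ V) u@(m∉ ∷ uV) sep =
  card-bijection (λ (D , c) D′ → D′ ≡ c ∷ D)
    (λ { {D , (x , m)} ((refl , norm , _) , refl , x<m , fits) → _ , (refl , x<m ∷ norm , fits) , refl })
    (λ { {c ∷ D} (refl , x<m ∷ norm , fits) → _ , ((refl , norm , fits-tail fits) , refl , x<m , fits) , refl })
    (λ { _ _ refl refl → refl }) (λ { _ _ refl refl → refl })
    (card-× (card-assignments cells V uV (sep ∘ there)) fibre)
  where
  instance
    m≢0 : NonZero m
    m≢0 = >-nonZero (proj₁ (sep (here refl)))
  point : ℤ → Congruence
  point z = z ℤ.%ℕ m , m
  Fibre : List Congruence → Congruence → Set
  Fibre D c = modulus c ≡ m × residue c < modulus c × Fits U (c ∷ D)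
  fibre : ∀ {D} → Assignment U V D → HasCardinality (Fibre D) (length zs ∸ length V)
  fibre {D} (refl , norm , fits) = map point (survivors D zs) ,
    AllPairs.map⁺ (AllPairs-map∈ (λ {y} {z} y∈ z∈ y≇z eq → y≇z (proj₂ (proj₂ (sep (here refl))) y z
      (proj₁ (Cells.sound rest y∈)) (proj₁ (Cells.sound rest z∈))
      (Satisfies⇒≅ (point y) {y} {z} (≅-% y m) (subst (z Satisfies_) (sym eq) (≅-% z m))))) (Cells.distinct rest)) ,
    (λ c → mk⇔ (to c) (from c)) ,
    trans (length-map point (survivors D zs)) (trans (sym (ℕ.m+n∸n≡m _ (length D)))
      (cong₂ _∸_ (length-survivors (Unique.map⁻ uV) D-sep cells fits) (sym (length-map modulus D))))
    where
    D-sep : Separating n U D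
    D-sep c∈ = proj₂ (sep (there (∈-map⁺ modulus c∈)))
    rest : Cells n (U ∖ D) (survivors D zs)
    rest = survivors-cells D cells (proj₁ ∘ D-sep)
    to : ∀ c → c ∈ map point (survivors D zs) → Fibre D c
    to c c∈ with z , z∈ , refl ← ∈-map⁻ point c∈ = refl , ℤ.n%ℕd<d z m ,
      fits-cons {n} (λ { (here refl) → proj₂ (sep (here refl)) ; (there c∈) → D-sep c∈ }) fits (Cells.sound rest z∈) (≅-% z m)
    from : ∀ c → Fibre D c → c ∈ map point (survivors D zs)
    from (x , m) (refl , x<m , fits′)
      with y , y∈ , y∈c ← fits⇒survivor (λ c∈ → Unique.Unique[x∷xs]⇒x∉xs u (∈-map⁺ modulus c∈)) fits′
      with z , z∈ , y≅z ← Cells.complete rest y∈ =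
      subst (_∈ map point (survivors D zs)) (cong (_, m) (residue-unique {z} (z ℤ.%ℕ m) x m (ℤ.n%ℕd<d z m) x<m
        (≅-% z m) (Satisfies-resp (x , m) {n} {y} {z} (proj₁ (proj₂ (sep (here refl)))) y≅z y∈c)))
        (∈-map⁺ point z∈)

children : ℤ → ℕ → ℕ → List ℤ
children z n a = map (child z n) (upTo a)

length-children : ∀ z n a → length (children z n a) ≡ a
length-children z n a = trans (length-map (child z n) (upTo a)) (length-upTo a)

children-cells : ∀ {n a} z .{{_ : NonZero n}} .{{_ : NonZero a}} → Cells (n * a) (_≅ z [ n ]) (children z n a)
children-cells {n} {a} z = record
  { complete = λ {y} y≅z → let j , j<a , y≅ = child-exists {a} {n} {y} y≅z in
      child z n j , ∈-map⁺ (child z n) (∈-upTo⁺ j<a) , y≅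
  ; sound    = λ w∈ → let j , _ , eq = ∈-map⁻ (child z n) w∈ in subst (_≅ z [ n ]) (sym eq) (≅-shift {n} z (+ j))
  ; distinct = AllPairs.map⁺ (AllPairs.applyUpTo⁺₁ id a
      (λ i<j j<a eq → ℕ.<⇒≢ i<j (child-injective {n} {a} z (ℕ.<-trans i<j j<a) j<a eq)))
  }

-- Coverings that leave one residue class uncovered

cells-resp : (∀ y → U y → U′ y) → (∀ y → U′ y → U y) → Cells n U zs → Cells n U′ zs
cells-resp f g cells = record
  { complete = λ {y} → complete ∘ g y
  ; sound    = λ {z} → f z ∘ sound
  ; distinct = distinct
  }
  where open Cells cells

fits-resp : (∀ y → U y → U′ y) → Fits U D → Fits U′ D
fits-resp f fits c c∈ = let y , uy , rest = fits c c∈ in y , f y uy , rest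

Uncovered : List Congruence → Region
Uncovered C y = ¬ Covered C y

uncovered-resp : ∀ C {y z} → (∀ {c} → c ∈ C → modulus c ∣ n) → y ≅ z [ n ] → Uncovered C y → Uncovered C z
uncovered-resp {n} C {y} {z} ∣n y≅z y∉ z∈ = let c , c∈ , z∈c = find z∈ in
  y∉ (Any.map (λ { refl → Satisfies-resp c {n} {z} {y} (∣n c∈) (≅-sym {n} {y} {z} y≅z) z∈c }) c∈)

uncovered-++ : ∀ C y → Uncovered C y → Uncovered D y → Uncovered (C ++ D) y
uncovered-++ C y y∉C y∉D = [ y∉C , y∉D ]′ ∘ Any.++⁻ C

uncovered-⊆ : (∀ {c} → c ∈ D → c ∈ C) → ∀ y → Uncovered C y → Uncovered D y
uncovered-⊆ D⊆C y y∉C y∈D = let c , c∈ , y∈c = find y∈D in y∉C (Any.map (λ { refl → y∈c }) (D⊆C c∈))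

separates-prime : Prime a → ∀ z → (∀ y → U y → y ≅ z [ n ]) → m ∣ n * a → ¬ m ∣ n → Separates (n * a) U m
separates-prime {n = n} a-prime z U⊆ m∣na m∤n = m∣na , λ x y ux uy x≅y →
  ≅-separate {y = x} {z = y} a-prime m∣na m∤n (≅-trans {n} {x} {z} {y} (U⊆ x ux) (≅-sym {n} {y} {z} (U⊆ y uy))) x≅y

∃-uncovered-child : .{{_ : NonZero n}} → Prime a → ∀ D y → (∀ {c} → c ∈ D → modulus c ∣ n * a × ¬ modulus c ∣ n) →
  length D < a → ∃[ w ] w ≅ y [ n ] × Uncovered D w
∃-uncovered-child {n} {a} a-prime D y D∣ |D|<a = first (survivors D (children y n a)) refl
  where
  instance
    a≢0 : NonZero a
    a≢0 = prime⇒nonZero a-prime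
  cells : Cells (n * a) (_≅ y [ n ]) (children y n a)
  cells = children-cells {n} {a} y
  sep : Separating (n * a) (_≅ y [ n ]) D
  sep c∈ = separates-prime {n = n} a-prime y (λ _ → id) (proj₁ (D∣ c∈)) (proj₂ (D∣ c∈))
  first : ∀ ws → survivors D (children y n a) ≡ ws → ∃[ w ] w ≅ y [ n ] × Uncovered D w
  first []      eq = contradiction
    (subst₂ _≤_ (length-children y n a) (cong (λ ws → length ws + length D) eq) (length-survivors≥ D sep cells))
    (ℕ.<⇒≱ |D|<a)
  first (w ∷ _) eq = w , Cells.sound (survivors-cells D cells (proj₁ ∘ sep)) (subst (w ∈_) (sym eq) (here refl))

Single : ℕ → List Congruence → ℤ → Set
Single n C z = ∀ y → (Uncovered C y → y ≅ z [ n ]) × (y ≅ z [ n ] → Uncovered C y)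

OneHole : ℕ → List ℕ → List Congruence → Set
OneHole n V C = map modulus C ≡ V × Normalised C × ∃ (Single n C)

Below Above : ℕ → List Congruence → List Congruence
Below n = filter (λ c → modulus c ∣? n)
Above n = filter (λ c → ¬? (modulus c ∣? n))

∈-Below⁻ : c ∈ Below n C → c ∈ C × modulus c ∣ n
∈-Below⁻ {n = n} = ∈-filter⁻ (λ c → modulus c ∣? n)

∈-Below⁺ : c ∈ C → modulus c ∣ n → c ∈ Below n C
∈-Below⁺ {n = n} = ∈-filter⁺ (λ c → modulus c ∣? n)

∈-Above⁻ : c ∈ Above n C → c ∈ C × ¬ modulus c ∣ n
∈-Above⁻ {n = n} = ∈-filter⁻ (λ c → ¬? (modulus c ∣? n))

uncovered-split : ∀ y → Uncovered (Below n C) y → Uncovered (Above n C) y → Uncovered C y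
uncovered-split {n} {C} y y∉B y∉A y∈ = let c , c∈ , y∈c = find y∈ in
  [ (λ c∈ → y∉A (Any.map (λ { refl → y∈c }) c∈)) , (λ c∈ → y∉B (Any.map (λ { refl → y∈c }) c∈)) ]′
    (∈-++⁻ (Above n C) (∈-resp-↭ (↭-sym (filter-↭ (λ c → modulus c ∣? n) C)) c∈))

length≤1 : ∀ {zs z} → AllPairs (λ y z → ¬ y ≅ z [ n ]) zs → (∀ {y} → y ∈ zs → y ≅ z [ n ]) → length zs ≤ 1
length≤1 {zs = []} _ _ = z≤n
length≤1 {zs = _ ∷ []} _ _ = s≤s z≤n
length≤1 {n} {x ∷ y ∷ _} {z} ((x≇y ∷ _) ∷ _) ≅z =
  contradiction (≅-trans {n} {x} {z} {y} (≅z (here refl)) (≅-sym {n} {y} {z} (≅z (there (here refl))))) x≇y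

FewNew : ℕ → ℕ → Set
FewNew n a = ∀ V → Unique V → (∀ {m} → m ∈ V → m ∣ n * a × ¬ m ∣ n) → length V < a

module _ {n a : ℕ} .{{_ : NonZero n}} (a-prime : Prime a) (few : FewNew n a) {C z}
  (u : Unique (map modulus C)) (C∣ : ∀ {c} → c ∈ C → modulus c ∣ n * a) (single : Single (n * a) C z) where

  private
    instance
      a≢0 : NonZero a
      a≢0 = prime⇒nonZero a-prime
    new : List Congruence
    new = Above n C
    D∣ : ∀ {c} → c ∈ new → modulus c ∣ n * a × ¬ modulus c ∣ n
    D∣ c∈ = let c∈C , ∤ = ∈-Above⁻ c∈ in C∣ c∈C , ∤
    |D|<a : length new < a
    |D|<a = subst (_< a) (length-map modulus new) (few (map modulus new)
      (AllPairs.map⁺ (AllPairs.filter⁺ _ (AllPairs.map⁻ u)))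
      λ m∈ → let c , c∈ , eq = ∈-map⁻ modulus m∈ in subst (λ m → m ∣ n * a × ¬ m ∣ n) (sym eq) (D∣ c∈))
    z∉Below : ∀ y → y ≅ z [ n ] → Uncovered (Below n C) y
    z∉Below y y≅z = uncovered-resp {n} (Below n C) {z} {y} (proj₂ ∘ ∈-Below⁻ {n = n} {C = C}) (≅-sym {n} {y} {z} y≅z)
      (uncovered-⊆ (proj₁ ∘ ∈-Below⁻) z (proj₂ (single z) (≅-refl {n * a} {z})))
    cells : Cells (n * a) (_≅ z [ n ]) (children z n a)
    cells = children-cells {n} {a} z
    sep : Separating (n * a) (_≅ z [ n ]) new
    sep c∈ = separates-prime {n = n} a-prime z (λ _ → id) (proj₁ (D∣ c∈)) (proj₂ (D∣ c∈))
    rest : Cells (n * a) ((_≅ z [ n ]) ∖ new) (survivors new (children z n a))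
    rest = survivors-cells new cells (proj₁ ∘ sep)
    -- A surviving child lies above `z`, hence escapes the old moduli, and it escapes the new ones
    -- as well; so it is the unique hole mod `n * a`.
    |rest|≤1 : length (survivors new (children z n a)) ≤ 1
    |rest|≤1 = length≤1 (Cells.distinct rest) λ {w} w∈ → let w≅z , w∉D = Cells.sound rest w∈ in
      proj₁ (single w) (uncovered-split w (z∉Below w w≅z) w∉D)
    a≤ : a ≤ length (survivors new (children z n a)) + length new
    a≤ = subst (_≤ length (survivors new (children z n a)) + length new) (length-children z n a) (length-survivors≥ new sep cells)

  -- A class mod `n` free of the old moduli has a child free of the new ones too. That child is the
  -- hole, so the class is that of `z`.
  single-below : Single n (Below n C) z
  single-below y = (λ y∉ → let w , w≅y , w∉D = ∃-uncovered-child {n} a-prime new y D∣ |D|<a in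
      ≅-trans {n} {y} {w} {z} (≅-sym {n} {w} {y} w≅y) (≅-weaken {y = w} {z = z} (m∣m*n a) (proj₁ (single w)
        (uncovered-split w (uncovered-resp {n} (Below n C) {y} {w} (proj₂ ∘ ∈-Below⁻ {n = n} {C = C}) (≅-sym {n} {w} {y} w≅y) y∉) w∉D))))
    , z∉Below y

  -- There are at most a - 1 new congruences, and they leave at most one of the a children, so
  -- equality holds throughout.
  length-above : suc (length (Above n C)) ≡ a
  length-above = ℕ.≤-antisym |D|<a (ℕ.≤-trans a≤ (ℕ.+-monoˡ-≤ (length new) |rest|≤1))

  fits-above : Fits (Uncovered (Below n C)) (Above n C)
  fits-above = fits-resp z∉Below (length⇒fits new sep cells (ℕ.≤-trans (ℕ.+-monoˡ-≤ (length new) |rest|≤1)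
    (ℕ.≤-reflexive (trans length-above (sym (length-children z n a))))))

same-moduli : ∀ B C → map modulus B ≡ map modulus C → Unique (map modulus B) → (∀ {c} → c ∈ B → c ∈ C) → B ≡ C
same-moduli []      []      _  _         _   = refl
same-moduli ((x , m) ∷ B) ((y , m′) ∷ C) eq u@(_ ∷ uB) B⊆C with refl ← ∷-injectiveˡ eq =
  cong₂ _∷_ head (same-moduli B C eq′ uB tail)
  where
  eq′ : map modulus B ≡ map modulus C
  eq′ = ∷-injectiveʳ eq
  m∉ : m ∉ map modulus B
  m∉ = Unique.Unique[x∷xs]⇒x∉xs u
  head : (x , m) ≡ (y , m)
  head with B⊆C (here refl)
  ... | here eq  = eq
  ... | there c∈ = contradiction (subst (m ∈_) (sym eq′) (∈-map⁺ modulus c∈)) m∉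
  tail : ∀ {c} → c ∈ B → c ∈ C
  tail c∈ with B⊆C (there c∈)
  ... | here refl = contradiction (∈-map⁺ modulus c∈) m∉
  ... | there c∈′ = c∈′

-- Distinct moduli in a prescribed order dictate the order of the congruences. This turns agreement
-- up to permutation into equality.
↭-same-moduli : ∀ {B C} → map modulus B ≡ map modulus C → Unique (map modulus B) → B ↭ C → B ≡ C
↭-same-moduli {B} {C} eq u B↭C = same-moduli B C eq u (∈-resp-↭ B↭C)

++-injective : {A : Set} (xs xs′ : List A) {ys ys′ : List A} → length xs ≡ length xs′ →
  xs ++ ys ≡ xs′ ++ ys′ → xs ≡ xs′ × ys ≡ ys′
++-injective []       []         _  eq = refl , eq
++-injective (x ∷ xs) (x′ ∷ xs′) len eq =
  let eqʰ , eqᵗ = ∷-injective eq ; p , q = ++-injective xs xs′ (ℕ.suc-injective len) eqᵗ in cong₂ _∷_ eqʰ p , q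

length-moduli : ∀ B C → map modulus B ≡ map modulus C → length B ≡ length C
length-moduli B C eq = trans (sym (length-map modulus B)) (trans (cong length eq) (length-map modulus C))

singleton-cells : ∀ {z} → Cells n U (z ∷ []) → ∀ y → U y → y ≅ z [ n ]
singleton-cells {n} cells y uy with z , here refl , y≅z ← Cells.complete cells {y} uy = y≅z

length≡1 : {A : Set} (xs : List A) → length xs ≡ 1 → ∃[ x ] xs ≡ x ∷ []
length≡1 (x ∷ []) _ = x , refl

-- One system with moduli `V` is presupposed, since the number may otherwise be 0; for all
-- admissible `V` it is the same `W`.
Count : ℕ → ℕ → Set
Count n W = ∀ V → Unique V → (∀ {m} → m ∈ V → 2 ≤ m × m ∣ n) → ∃ (OneHole n V) → HasCardinality (OneHole n V) W

count-1 : Count 1 1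
count-1 [] _ _ _ = ([] ∷ []) , ([] ∷ []) , (λ C → mk⇔
  (λ { (here refl) → refl , [] , + 0 , λ y → (λ _ → 1∣ _) , λ _ () })
  (λ { (eq , _) → here (empty C eq) })) , refl
  where
  empty : ∀ C → map modulus C ≡ [] → C ≡ []
  empty [] _ = refl
count-1 (m ∷ V) _ V∣ _ with 2≤m , m∣1 ← V∣ (here refl) = contradiction (∣⇒≤ m∣1) (ℕ.<⇒≱ 2≤m)

module _ {n a W : ℕ} .{{_ : NonZero n}} (a-prime : Prime a) (few : FewNew n a) (count : Count n W) where

  -- The moduli dividing `n` form a one-hole system by themselves. The others, a - 1 in number, go
  -- to distinct children of its hole, and the child left over is the new hole.
  count-* : Count (n * a) (W * a !)
  count-* V uV V∣ (C₁ , eq₁ , norm₁ , z₁ , single₁) =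
    card-bijection (λ (C , D) B → D ++ C ↭ B) fwd bwd
      (λ { {C , D} {C′ , D′} ((eqC , _) , (eqD , _)) ((eqC′ , _) , (eqD′ , _)) D++C↭ D′++C′↭ →
        let eq , eq′ = ++-injective D D′ (length-moduli D D′ (trans eqD (sym eqD′)))
                         (↭-same-moduli (trans (moduli-++ D C eqD eqC) (sym (moduli-++ D′ C′ eqD′ eqC′)))
                           (subst Unique (sym (moduli-++ D C eqD eqC)) uV₁₀) (↭-trans D++C↭ (↭-sym D′++C′↭)))
        in cong₂ _,_ eq′ eq })
      (λ (eqB , _) (eqB′ , _) ↭B ↭B′ →
        ↭-same-moduli (trans eqB (sym eqB′)) (subst Unique (sym eqB) uV) (↭-trans (↭-sym ↭B) ↭B′))
      (card-× (count V₀ (Unique.filter⁺ (_∣? n) uV) (λ m∈ → let m∈V , m∣n = ∈-filter⁻ (_∣? n) m∈ in proj₁ (V∣ m∈V) , m∣n)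
                (_ , restrict eq₁ norm₁ single₁)) fibre)
    where
    instance
      a≢0 : NonZero a
      a≢0 = prime⇒nonZero a-prime
    V₀ V₁ : List ℕ
    V₀ = filter (_∣? n) V
    V₁ = filter (¬? ∘ (_∣? n)) V
    V₁++V₀↭V : V₁ ++ V₀ ↭ V
    V₁++V₀↭V = filter-↭ (_∣? n) V
    uV₁₀ : Unique (V₁ ++ V₀)
    uV₁₀ = Unique-resp-↭ (↭-sym V₁++V₀↭V) uV
    uV₁ : Unique V₁
    uV₁ = Unique.filter⁺ (¬? ∘ (_∣? n)) uV
    V₁∣ : ∀ {m} → m ∈ V₁ → 0 < m × m ∣ n * a × ¬ m ∣ n
    V₁∣ m∈ = let m∈V , m∤n = ∈-filter⁻ (¬? ∘ (_∣? n)) m∈ ; 2≤m , m∣na = V∣ m∈V in ℕ.<⇒≤ 2≤m , m∣na , m∤n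
    moduli-++ : ∀ D C → map modulus D ≡ V₁ → map modulus C ≡ V₀ → map modulus (D ++ C) ≡ V₁ ++ V₀
    moduli-++ D C eqD eqC = trans (map-++ modulus D C) (cong₂ _++_ eqD eqC)
    module Restrict {C z} (eq : map modulus C ≡ V) (single : Single (n * a) C z) where
      u : Unique (map modulus C)
      u = subst Unique (sym eq) uV
      C∣ : ∀ {c} → c ∈ C → modulus c ∣ n * a
      C∣ c∈ = proj₂ (V∣ (∈-moduli eq c∈))
      eq-above : map modulus (Above n C) ≡ V₁
      eq-above = trans (map-filter (¬? ∘ (_∣? n)) modulus C) (cong (filter (¬? ∘ (_∣? n))) eq)
    restrict : ∀ {C z} → map modulus C ≡ V → Normalised C → Single (n * a) C z → OneHole n V₀ (Below n C)
    restrict {C} eq norm single = trans (map-filter (_∣? n) modulus C) (cong (filter (_∣? n)) eq) ,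
      All.filter⁺ _ norm , _ , single-below a-prime few u C∣ single
      where open Restrict eq single
    -- Read off from the given system `C₁`, but a statement about `V` alone, hence available for
    -- every other system.
    1+|V₁|≡a : suc (length V₁) ≡ a
    1+|V₁|≡a = trans (cong suc (trans (cong length (sym eq-above)) (length-map modulus (Above n C₁))))
      (length-above a-prime few u C∣ single₁)
      where open Restrict eq₁ single₁
    hole-cells : ∀ {C z} → Single n C z → Cells (n * a) (Uncovered C) (children z n a)
    hole-cells {C} {z} single = cells-resp (λ y → proj₂ (single y)) (λ y → proj₁ (single y)) (children-cells {n} {a} z)
    fibre : ∀ {C} → OneHole n V₀ C → HasCardinality (Assignment (Uncovered C) V₁) (a !)
    fibre {C} (_ , _ , z , single) = subst (HasCardinality (Assignment (Uncovered C) V₁)) count≡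
      (card-assignments (hole-cells single) V₁ uV₁ λ m∈ → let 0<m , m∣na , m∤n = V₁∣ m∈ in
        0<m , separates-prime {n = n} a-prime z (λ y → proj₁ (single y)) m∣na m∤n)
      where
      count≡ : fall (length (children z n a)) (length V₁) ≡ a !
      count≡ = trans (cong (λ b → fall b (length V₁)) (trans (length-children z n a) (sym 1+|V₁|≡a)))
        (trans (fall-pred (length V₁)) (cong _! 1+|V₁|≡a))
    bwd : ∀ {B} → OneHole (n * a) V B → ∃[ (C , D) ] (OneHole n V₀ C × Assignment (Uncovered C) V₁ D) × D ++ C ↭ B
    bwd {B} (eq , norm , z , single) = (Below n B , Above n B) ,
      (restrict eq norm single , eq-above , All.filter⁺ _ norm , fits-above a-prime few u C∣ single) ,
      filter-↭ (λ c → modulus c ∣? n) B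
      where open Restrict eq single
    fwd : ∀ {(C , D) : List Congruence × List Congruence} → OneHole n V₀ C × Assignment (Uncovered C) V₁ D →
      ∃[ B ] OneHole (n * a) V B × D ++ C ↭ B
    fwd {C , D} ((eqC , normC , z , single) , (eqD , normD , fits))
      with B , V≡ , ↭B ← ↭-map-inv modulus {D ++ C} (subst (_↭ V) (sym (moduli-++ D C eqD eqC)) V₁++V₀↭V)
      = B , (sym V≡ , All-resp-↭ ↭B (All.++⁺ normD normC) , w , λ y → to y , from y) , ↭B
      where
      cells : Cells (n * a) (Uncovered C) (children z n a)
      cells = hole-cells single
      sep : Separating (n * a) (Uncovered C) D
      sep c∈ = let _ , m∣na , m∤n = V₁∣ (∈-moduli eqD c∈) in
        separates-prime {n = n} a-prime z (λ y → proj₁ (single y)) m∣na m∤n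
      rest : Cells (n * a) (Uncovered C ∖ D) (survivors D (children z n a))
      rest = survivors-cells D cells (proj₁ ∘ sep)
      |rest|≡1 : length (survivors D (children z n a)) ≡ 1
      |rest|≡1 = ℕ.+-cancelʳ-≡ (length D) _ 1 (trans (length-survivors
        (Unique.map⁻ (subst Unique (sym eqD) uV₁)) sep cells fits)
        (trans (length-children z n a) (trans (sym 1+|V₁|≡a) (cong suc (trans (cong length (sym eqD)) (length-map modulus D))))))
      w : ℤ
      w = proj₁ (length≡1 (survivors D (children z n a)) |rest|≡1)
      rest′ : Cells (n * a) (Uncovered C ∖ D) (w ∷ [])
      rest′ = subst (Cells (n * a) (Uncovered C ∖ D)) (proj₂ (length≡1 (survivors D (children z n a)) |rest|≡1)) rest
      B∣ : ∀ {c} → c ∈ B → modulus c ∣ n * a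
      B∣ c∈ = proj₂ (V∣ (∈-moduli (sym V≡) c∈))
      to : ∀ y → Uncovered B y → y ≅ w [ n * a ]
      to y y∉B = singleton-cells rest′ y
        (uncovered-⊆ (∈-resp-↭ ↭B ∘ ∈-++⁺ʳ D) y y∉B , uncovered-⊆ (∈-resp-↭ ↭B ∘ ∈-++⁺ˡ) y y∉B)
      from : ∀ y → y ≅ w [ n * a ] → Uncovered B y
      from y y≅w = let w∉C , w∉D = Cells.sound rest′ (here refl) in
        uncovered-resp {n * a} B {w} {y} B∣ (≅-sym {n * a} {y} {w} y≅w)
          (uncovered-⊆ (∈-resp-↭ (↭-sym ↭B)) w (uncovered-++ D w w∉D w∉C))

-- Holes and new moduli

-- Only completeness is recorded: the length of the list serves as an upper bound for the number of
-- divisors.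
HasDivisors : ℕ → List ℕ → Set
HasDivisors A ds = ∀ {d} → d ∣ A → d ∈ ds

divisors-*^ : ℕ → ℕ → List ℕ → List ℕ
divisors-*^ a j ds = cartesianProductWith (λ i d → a ^ i * d) (upTo (suc j)) ds

length-divisors-*^ : ∀ a j ds → length (divisors-*^ a j ds) ≡ suc j * length ds
length-divisors-*^ a j ds = trans (length-cartesianProductWith (λ i d → a ^ i * d) (upTo (suc j)) ds)
  (cong (_* length ds) (length-upTo (suc j)))

hasDivisors-*^ : ∀ {ds} j → Prime a → HasDivisors A ds → HasDivisors (A * a ^ j) (divisors-*^ a j ds)
hasDivisors-*^ {a} {A} j a-prime has {m} m∣ with i , d , i≤j , d∣A , refl ← ∣*^⇒ {A = A} j a-prime m∣ =
  ∈-cartesianProductWith⁺ (λ i d → a ^ i * d) (∈-upTo⁺ (s≤s i≤j)) (has d∣A)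

*^-suc : ∀ A a j → A * a ^ j * a ≡ A * a ^ suc j
*^-suc A a j = trans (ℕ.*-assoc A (a ^ j) a) (cong (A *_) (ℕ.*-comm (a ^ j) a))

-- A factorisation with exponent of `a` at most `j` would already divide A a^j. Hence a layer has no
-- more moduli than `A` has divisors.
new-divisor : ∀ j → Prime a → m ∣ A * a ^ j * a → ¬ m ∣ A * a ^ j → ∃[ d ] d ∣ A × m ≡ a ^ suc j * d
new-divisor {a} {m} {A} j a-prime m∣ m∤ with ∣*^⇒ {A = A} (suc j) a-prime (subst (m ∣_) (*^-suc A a j) m∣)
... | i , d , i≤ , d∣A , refl with ℕ.m≤n⇒m<n∨m≡n i≤
... | inj₂ refl      = d , d∣A , refl
... | inj₁ (s≤s i≤j) = contradiction (subst (a ^ i * d ∣_) (ℕ.*-comm (a ^ j) A) (*-pres-∣ (^-mono-∣ i≤j) d∣A)) m∤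

new-divisor₁ : Prime a → m ∣ n * a → ¬ m ∣ n → ∃[ d ] d ∣ n × m ≡ a * d
new-divisor₁ {a} {m} {n} a-prime m∣ m∤ with d , d∣n , refl ← new-divisor {a} {m} {n} 0 a-prime
    (subst (λ x → m ∣ x * a) (sym (ℕ.*-identityʳ n)) m∣) (m∤ ∘ subst (m ∣_) (ℕ.*-identityʳ n)) =
  d , d∣n , cong (_* d) (ℕ.*-identityʳ a)

few-new : ∀ {ds} → Prime a → HasDivisors A ds → length ds < a → ∀ j → FewNew (A * a ^ j) a
few-new {a} {A} {ds} a-prime has |ds|<a j V uV V∣ = ℕ.≤-<-trans
  (subst (length V ≤_) (length-map (a ^ suc j *_) ds) (length-⊆ uV λ m∈ →
    let m∣ , m∤ = V∣ m∈ ; d , d∣A , eq = new-divisor {A = A} j a-prime m∣ m∤ in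
    subst (_∈ map (a ^ suc j *_) ds) (sym eq) (∈-map⁺ (a ^ suc j *_) (has d∣A))))
  |ds|<a

uncovered-below : m ∣ n → ∀ y → Uncovered (Below n C) y → Uncovered (Below m C) y
uncovered-below {m} {n} {C} m∣n = uncovered-⊆ λ c∈ → let c∈C , ∣m = ∈-Below⁻ {n = m} {C = C} c∈ in ∈-Below⁺ c∈C (∣-trans ∣m m∣n)

New : ℕ → ℕ → List Congruence → List Congruence
New n a C = Above n (Below (n * a) C)

∈-New⁻ : c ∈ New n a C → modulus c ∣ n * a × ¬ modulus c ∣ n
∈-New⁻ {n = n} {a} {C} c∈ = let c∈′ , ∤ = ∈-Above⁻ {n = n} {C = Below (n * a) C} c∈ in
  proj₂ (∈-Below⁻ {n = n * a} {C = C} c∈′) , ∤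

new-moduli : Unique (map modulus C) → Unique (map modulus (New n a C))
new-moduli u = AllPairs.map⁺ (AllPairs.filter⁺ _ (AllPairs.filter⁺ _ (AllPairs.map⁻ u)))

uncovered-new : ∀ y → Uncovered (Below n C) y → Uncovered (New n a C) y → Uncovered (Below (n * a) C) y
uncovered-new {n} {C} {a} y y∉ = uncovered-split {n} {Below (n * a) C} y (uncovered-⊆ (λ c∈ →
  let c∈′ , ∣n = ∈-Below⁻ {n = n} {C = Below (n * a) C} c∈ in ∈-Below⁺ (proj₁ (∈-Below⁻ {n = n * a} {C = C} c∈′)) ∣n) y y∉)

length-New : FewNew n a → Unique (map modulus C) → length (New n a C) < a
length-New {n} {a} {C} few u = subst (_< a) (length-map modulus (New n a C)) (few _ (new-moduli {C} {n} {a} u)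
  λ m∈ → let c , c∈ , eq = ∈-map⁻ modulus m∈ in subst (λ m → m ∣ n * a × ¬ m ∣ n) (sym eq) (∈-New⁻ {n = n} {a} {C} c∈))

hole-step : .{{_ : NonZero n}} → Prime a → FewNew n a → Unique (map modulus C) → ∀ y → Uncovered (Below n C) y →
  ∃[ w ] w ≅ y [ n ] × Uncovered (Below (n * a) C) w
hole-step {n} {a} {C} a-prime few u y y∉ =
  let w , w≅y , w∉ = ∃-uncovered-child {n} a-prime (New n a C) y (∈-New⁻ {n = n} {a} {C}) (length-New {n} {a} {C} few u) in
  w , w≅y , uncovered-new {n} {C} {a} w
    (uncovered-resp {n} (Below n C) {y} {w} (proj₂ ∘ ∈-Below⁻ {n = n} {C = C}) (≅-sym {n} {w} {y} w≅y) y∉) w∉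

hole-^ : ∀ {ds} → .{{_ : NonZero A}} → Prime a → HasDivisors A ds → length ds < a → Unique (map modulus C) →
  ∀ j i y → Uncovered (Below (A * a ^ j) C) y → ∃[ w ] w ≅ y [ A * a ^ j ] × Uncovered (Below (A * a ^ (i + j)) C) w
hole-^ {A} {a} a-prime has few u j zero    y y∉ = y , ≅-refl {A * a ^ j} {y} , y∉
hole-^ {A} {a} {C} a-prime has few u j (suc i) y y∉ =
  let w  , w≅y  , w∉  = hole-^ a-prime has few u j i y y∉
      w′ , w′≅w , w′∉ = hole-step {{A*a^≢0}} a-prime (few-new a-prime has few (i + j)) u w w∉
  in w′ , ≅-trans {A * a ^ j} {w′} {w} {y} (≅-weaken {A * a ^ j} {A * a ^ (i + j)} {w′} {w} (*-monoʳ-∣ A (^-mono-∣ (ℕ.m≤n+m j i))) w′≅w) w≅y ,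
    subst (λ n → Uncovered (Below n C) w′) (*^-suc A a (i + j)) w′∉
  where
  instance
    a≢0 : NonZero a
    a≢0 = prime⇒nonZero a-prime
    A*a^≢0 : NonZero (A * a ^ (i + j))
    A*a^≢0 = ℕ.m*n≢0 A (a ^ (i + j)) {{it}} {{ℕ.m^n≢0 a (i + j)}}

module TwoHoles .{{_ : NonZero n}} (a-prime : Prime a) (D : List Congruence)
  (D∣ : ∀ {c} → c ∈ D → modulus c ∣ n * a × ¬ modulus c ∣ n) where

  private instance
    a≢0 : NonZero a
    a≢0 = prime⇒nonZero a-prime

  Hits : ℤ → Congruence → Set
  Hits w c = Any (_Satisfies c) (children w n a)

  hits? : ∀ w → Decidable (Hits w)
  hits? w c = any? (satisfies? c) (children w n a)

  hitting : ℤ → List Congruence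
  hitting w = filter (hits? w) D

  holes : ℤ → List ℤ
  holes w = survivors (hitting w) (children w n a)

  both : ℤ → ℤ → List Congruence
  both w w′ = filter (λ c → hits? w c ×-dec hits? w′ c) D

  private
    cells : ∀ w → Cells (n * a) (_≅ w [ n ]) (children w n a)
    cells w = children-cells {n} {a} w

    sep : ∀ w → Separating (n * a) (_≅ w [ n ]) (hitting w)
    sep w {c} c∈ = let ∣na , ∤n = D∣ (proj₁ (∈-filter⁻ (hits? w) c∈)) in separates-prime {n = n} a-prime w (λ _ → id) ∣na ∤n

    rest : ∀ w → Cells (n * a) ((_≅ w [ n ]) ∖ hitting w) (holes w)
    rest w = survivors-cells (hitting w) (cells w) (proj₁ ∘ sep w)

  holes-distinct : ∀ w → AllPairs (λ y z → ¬ y ≅ z [ n * a ]) (holes w)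
  holes-distinct w = Cells.distinct (rest w)

  holes-sound : ∀ w {y} → y ∈ holes w → y ≅ w [ n ] × Uncovered D y
  holes-sound w {y} y∈ = let y≅w , y∉ = Cells.sound (rest w) y∈ in y≅w ,
    λ y∈D → let c , c∈ , y∈c = find y∈D in y∉ (Any.map (λ { refl → y∈c }) (∈-filter⁺ (hits? w) c∈
      (Any.map (λ { refl → y∈c }) (survivors-⊆ (hitting w) y∈))))

  both-∣ : ∀ w w′ {c} → c ∈ both w w′ → c ∈ D × modulus c ∣ a * ℤ.∣ w ℤ.- w′ ∣
  both-∣ w w′ {c} c∈ =
    let c∈D , hit , hit′ = ∈-filter⁻ (λ c → hits? w c ×-dec hits? w′ c) c∈
        y  , y∈  , y∈c  = find hit
        y′ , y′∈ , y′∈c = find hit′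
    in c∈D , ≅-scale {n = n} {w} {w′} {y} {y′} a (proj₁ (D∣ c∈D))
      (Cells.sound (cells w) y∈) (Cells.sound (cells w′) y′∈) (Satisfies⇒≅ c {y} {y′} y∈c y′∈c)

  -- Each class has `a` children and loses at most one to each congruence that hits it. In the sum
  -- over both classes a congruence is counted twice only if it is in `both`.
  count-holes : ∀ w w′ → a + a ≤ (length (holes w) + length (holes w′)) + (length D + length (both w w′))
  count-holes w w′ = begin
    a + a ≤⟨ ℕ.+-mono-≤ (bound w) (bound w′) ⟩
    (length (holes w) + length (hitting w)) + (length (holes w′) + length (hitting w′))
      ≡⟨ interchange (length (holes w)) (length (hitting w)) (length (holes w′)) (length (hitting w′)) ⟩
    (length (holes w) + length (holes w′)) + (length (hitting w) + length (hitting w′))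
      ≤⟨ ℕ.+-monoʳ-≤ (length (holes w) + length (holes w′)) (length-filter-+ (hits? w) (hits? w′) D) ⟩
    (length (holes w) + length (holes w′)) + (length D + length (both w w′)) ∎
    where
    open ℕ.≤-Reasoning
    bound : ∀ w → a ≤ length (holes w) + length (hitting w)
    bound w = subst (_≤ length (holes w) + length (hitting w)) (length-children w n a) (length-survivors≥ (hitting w) (sep w) (cells w))
    interchange : ∀ x y z t → (x + y) + (z + t) ≡ (x + z) + (y + t)
    interchange = ℕ-solve-∀

-- Uniqueness of the hole

-- A is the product of the prime powers treated so far, a the next prime, and W the number of ways to choose
-- residues for given moduli dividing A so that a single class mod A stays uncovered.
record Stage (A a W : ℕ) : Set where
  field
    isPrime        : Prime a
    base≢0         : NonZero A
    divisors       : List ℕ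
    hasDivisors    : HasDivisors A divisors
    divisors-count : suc (length divisors) ≡ a
    coprime        : ∀ {b} → Prime b → a ≤ b → ¬ b ∣ A
    count          : Count A W
    hole           : ∀ C → Unique (map modulus C) → (∀ {c} → c ∈ C → 2 ≤ modulus c) → ∃ (Uncovered (Below A C))

  divisors-few : length divisors < a
  divisors-few = ℕ.≤-reflexive divisors-count

  instance
    a≢0 : NonZero a
    a≢0 = prime⇒nonZero isPrime

  base-*^≢0 : ∀ j → NonZero (A * a ^ j)
  base-*^≢0 j = ℕ.m*n≢0 A (a ^ j) {{base≢0}} {{ℕ.m^n≢0 a j}}

  count-*^ : ∀ j → Count (A * a ^ j) (W * (a !) ^ j)
  count-*^ zero    = subst₂ Count (sym (ℕ.*-identityʳ A)) (sym (ℕ.*-identityʳ W)) count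
  count-*^ (suc j) = subst₂ Count (*^-suc A a j) (*^-suc W (a !) j)
    (count-* {{base-*^≢0 j}} isPrime (few-new isPrime hasDivisors divisors-few j) (count-*^ j))

  extend : ∀ {C} → Unique (map modulus C) → ∀ j i y → Uncovered (Below (A * a ^ j) C) y →
    ∃[ w ] w ≅ y [ A * a ^ j ] × Uncovered (Below (A * a ^ (i + j)) C) w
  extend = hole-^ {{base≢0}} isPrime hasDivisors divisors-few

  hole-*^ : ∀ C → Unique (map modulus C) → (∀ {c} → c ∈ C → 2 ≤ modulus c) → ∀ j → ∃ (Uncovered (Below (A * a ^ j) C))
  hole-*^ C u ≥2 j =
    let y , y∉ = hole C u ≥2
        w , _ , w∉ = extend u 0 j y (subst (λ n → Uncovered (Below n C) y) (sym (ℕ.*-identityʳ A)) y∉)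
    in w , subst (λ j → Uncovered (Below (A * a ^ j) C) w) (ℕ.+-identityʳ j) w∉

stage-first : Stage 1 2 1
stage-first = record
  { isPrime        = prime[2]
  ; base≢0         = _
  ; divisors       = 1 ∷ []
  ; hasDivisors    = here ∘ ∣1⇒≡1
  ; divisors-count = refl
  ; coprime        = λ b-prime _ b∣1 → ¬prime[1] (subst Prime (∣1⇒≡1 b∣1) b-prime)
  ; count          = count-1
  ; hole           = λ C _ ≥2 → + 0 , λ y∈ → let c , c∈ , _ = find y∈ ; c∈C , ∣1 = ∈-Below⁻ {n = 1} {C = C} c∈ in
                       ℕ.<⇒≱ (≥2 c∈C) (∣⇒≤ ∣1)
  }

-- The last hypothesis is (j + 1)(a - 1) = b - 1. The a - 1 divisors listed for `A` become b - 1 for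
-- A a^j, so the invariant `divisors-count` passes to the next prime.
stage-next : ∀ j → Stage A a W → Prime b → a < b → suc (suc j * (a ∸ 1)) ≡ b → Stage (A * a ^ j) b (W * (a !) ^ j)
stage-next {A} {a} {W} {b} j stage b-prime a<b eq = record
  { isPrime        = b-prime
  ; base≢0         = base-*^≢0 j
  ; divisors       = divisors-*^ a j divisors
  ; hasDivisors    = hasDivisors-*^ j isPrime hasDivisors
  ; divisors-count = trans (cong suc (trans (length-divisors-*^ a j divisors)
                       (cong (λ x → suc j * (x ∸ 1)) divisors-count))) eq
  ; coprime        = λ c-prime b≤c → prime∤* c-prime (coprime c-prime (ℕ.≤-trans (ℕ.<⇒≤ a<b) b≤c))
                       (prime∤^ j c-prime (prime∤prime c-prime isPrime (ℕ.<⇒≢ (ℕ.<-≤-trans a<b b≤c) ∘ sym)))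
  ; count          = count-*^ j
  ; hole           = λ C u ≥2 → hole-*^ C u ≥2 j
  }
  where open Stage stage

-- Here k + 1 is the exponent of `p`, so the n of the overview is A p^k, and `k-bound` is the floor
-- that defines this exponent.
module Structure {A p W P k : ℕ} (stage : Stage A p W) (P-prime : Prime P) (p<P : p < P)
  (k-bound : suc k * (p ∸ 1) < P) (P-bound : (p ∸ 2) * (p ∸ 3) ≤ P)
  {C : List Congruence} (u : Unique (map modulus C)) (≥2 : ∀ {c} → c ∈ C → 2 ≤ modulus c)
  (C∣ : ∀ {c} → c ∈ C → modulus c ∣ A * p ^ suc k * P) (covers : ∀ z → Covered C z) where

  open Stage stage

  private
    N q : ℕ
    N = A * p ^ suc k
    q = length divisors

    Hole : ℕ → ℤ → Set
    Hole n = Uncovered (Below n C)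

    p≡1+q : p ≡ suc q
    p≡1+q = sym divisors-count

    k-bound′ : suc k * q < P
    k-bound′ = subst (λ x → suc k * (x ∸ 1) < P) p≡1+q k-bound

    hasDivisors-N : HasDivisors N (divisors-*^ p (suc k) divisors)
    hasDivisors-N = hasDivisors-*^ (suc k) isPrime hasDivisors

    lastNew : List Congruence
    lastNew = New N P C

    lastNew∣ : ∀ {c} → c ∈ lastNew → modulus c ∣ N * P × ¬ modulus c ∣ N
    lastNew∣ = ∈-New⁻ {n = N} {P} {C}

    uNew : Unique (map modulus lastNew)
    uNew = new-moduli {C} {N} {P} u

    open TwoHoles {n = N} {{base-*^≢0 (suc k)}} P-prime lastNew lastNew∣

    lastNew-divisor : ∀ {c} → c ∈ lastNew → ∃[ d ] d ∣ N × modulus c ≡ P * d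
    lastNew-divisor c∈ = let ∣NP , ∤N = lastNew∣ c∈ in new-divisor₁ {n = N} P-prime ∣NP ∤N

    -- Every modulus divides N P, so above a hole mod `N` only the congruences in `lastNew` can do
    -- the covering.
    no-holes : ∀ y → Hole N y → length (holes y) ≡ 0
    no-holes y y∉ = empty (holes y) λ {w} w∈ →
      let w≅y , w∉new = holes-sound y {w} w∈ in
      uncovered-new {N} {C} {P} w (uncovered-resp {N} (Below N C) {y} {w} (proj₂ ∘ ∈-Below⁻ {n = N} {C = C}) (≅-sym {N} {w} {y} w≅y) y∉)
        w∉new (let c , c∈ , w∈c = find (covers w) in Any.map (λ { refl → w∈c }) (∈-Below⁺ c∈ (C∣ c∈)))
      where
      empty : (ws : List ℤ) → (∀ {w} → w ∈ ws → ⊥) → length ws ≡ 0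
      empty []      _   = refl
      empty (w ∷ _) out = ⊥-elim (out (here refl))

    length-lastNew : length lastNew ≤ suc (suc k) * q
    length-lastNew = begin
      length lastNew                                             ≡⟨ length-map modulus lastNew ⟨
      length (map modulus lastNew)                               ≤⟨ length-⊆ uNew lastNew⊆ ⟩
      length (map (P *_) (divisors-*^ p (suc k) divisors)) ≡⟨ length-map (P *_) (divisors-*^ p (suc k) divisors) ⟩
      length (divisors-*^ p (suc k) divisors)              ≡⟨ length-divisors-*^ p (suc k) divisors ⟩
      suc (suc k) * q                                      ∎
      where
      open ℕ.≤-Reasoning
      lastNew⊆ : ∀ {m} → m ∈ map modulus lastNew → m ∈ map (P *_) (divisors-*^ p (suc k) divisors)
      lastNew⊆ m∈ = let c , c∈ , m≡ = ∈-map⁻ modulus m∈ ; d , d∣N , c≡ = lastNew-divisor c∈ in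
        subst (_∈ map (P *_) (divisors-*^ p (suc k) divisors)) (sym (trans m≡ c≡)) (∈-map⁺ (P *_) (hasDivisors-N d∣N))

    -- Each of the P residues mod N P above a hole needs its own modulus P d; those usable by both holes have d ∣ y − y′.
    two-holes : ∀ ds y y′ → Hole N y → Hole N y′ → (∀ {d} → d ∣ N → d ∣ ℤ.∣ y ℤ.- y′ ∣ → d ∈ ds) →
      P + P ≤ suc (suc k) * q + length ds
    two-holes ds y y′ y∉ y′∉ ds-complete = begin
      P + P                                                                   ≤⟨ count-holes y y′ ⟩
      (length (holes y) + length (holes y′)) + (length lastNew + length (both y y′)) ≡⟨ cong (_+ (length lastNew + length (both y y′)))
                                                                                    (cong₂ _+_ (no-holes y y∉) (no-holes y′ y′∉)) ⟩
      length lastNew + length (both y y′)                                           ≤⟨ ℕ.+-mono-≤ length-lastNew both≤ ⟩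
      suc (suc k) * q + length ds                                             ∎
      where
      open ℕ.≤-Reasoning
      both⊆ : ∀ {m} → m ∈ map modulus (both y y′) → m ∈ map (P *_) ds
      both⊆ m∈ =
        let c , c∈ , m≡ = ∈-map⁻ modulus m∈
            c∈new , c∣ = both-∣ y y′ c∈
            d , d∣N , c≡ = lastNew-divisor c∈new
        in subst (_∈ map (P *_) ds) (sym (trans m≡ c≡)) (∈-map⁺ (P *_) (ds-complete d∣N
             (*-cancelˡ-∣ P {{prime⇒nonZero P-prime}} (subst (_∣ P * ℤ.∣ y ℤ.- y′ ∣) c≡ c∣))))
      both≤ : length (both y y′) ≤ length ds
      both≤ = subst₂ _≤_ (length-map modulus (both y y′)) (length-map (P *_) ds)
        (length-⊆ (AllPairs.map⁺ (AllPairs.filter⁺ _ (AllPairs.map⁻ uNew))) both⊆)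

    p^∣⇒< : ∀ {i d j v} → p ^ i * d ∣ v → ¬ p ^ j ∣ v → i < j
    p^∣⇒< {i} {d} {j} {v} d∣v p^j∤v = ℕ.≰⇒> λ j≤i → p^j∤v (∣-trans (^-mono-∣ j≤i) (∣-trans (m∣m*n d) d∣v))

    -- Otherwise the common divisors of `N` and y - y′ have the form p^i d with i < k and d ∣ A, at
    -- most k q in number. Then 2 P ≤ (k + 2) q + k q = 2 (k + 1) q, against (k + 1) q < P.
    holes-≅-p^ : ∀ y y′ → Hole N y → Hole N y′ → y ≅ y′ [ p ^ k ]
    holes-≅-p^ y y′ y∉ y′∉ with p ^ k ∣? ℤ.∣ y ℤ.- y′ ∣
    ... | yes y≅y′ = y≅y′
    ... | no  y≇y′ = contradiction bound (ℕ.<⇒≱ (subst (_< P + P) (double k q) (ℕ.+-mono-< k-bound′ k-bound′)))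
      where
      double : ∀ k q → suc k * q + suc k * q ≡ suc (suc k) * q + k * q
      double = ℕ-solve-∀
      common : List ℕ
      common = cartesianProductWith (λ i d → p ^ i * d) (upTo k) divisors
      bound : P + P ≤ suc (suc k) * q + k * q
      bound = subst (λ l → P + P ≤ suc (suc k) * q + l) (trans (length-cartesianProductWith (λ i d → p ^ i * d) (upTo k) divisors) (cong (_* q) (length-upTo k)))
        (two-holes common y y′ y∉ y′∉ λ d∣N d∣v → let i , e , _ , e∣A , eq = ∣*^⇒ {A = A} (suc k) isPrime d∣N in
          subst (_∈ common) (sym eq) (∈-cartesianProductWith⁺ (λ i d → p ^ i * d)
            (∈-upTo⁺ (p^∣⇒< {i} {e} {k} (subst (_∣ ℤ.∣ y ℤ.- y′ ∣) eq d∣v) y≇y′)) (hasDivisors e∣A)))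

    proper : List ℕ
    proper = filter (λ d → ¬? (d ℕ.≟ A)) divisors

    length-proper : suc (length proper) ≤ q
    length-proper = filter-notAll (λ d → ¬? (d ℕ.≟ A)) divisors
      (Any.map (λ { refl ≢A → ≢A refl }) (hasDivisors (∣-refl {A})))

    ∈-proper : ∀ {d v} → d ∣ A → d ∣ v → ¬ A ∣ v → d ∈ proper
    ∈-proper {d} d∣A d∣v A∤v = ∈-filter⁺ (λ d → ¬? (d ℕ.≟ A)) (hasDivisors d∣A) λ { refl → A∤v d∣v }

    -- For k = 0 the congruence mod p^k is empty, and the bound on `P` steps in. Since p = q + 1,
    -- the estimate 2 P < 3 q with P > p forces q ≥ 5, and then 2 P ≥ 2 (q - 1)(q - 2) > 3 q.
    small-k : k ≡ 0 → P + P ≤ suc (suc k) * q + length proper → ⊥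
    small-k refl bound = arithmetic q (ℕ.≤-trans (ℕ.≤-reflexive (ℕ.+-comm 1 (P + P))) (ℕ.≤-trans (ℕ.+-monoˡ-≤ 1 bound)
        (ℕ.≤-trans (ℕ.≤-reflexive (ℕ.+-assoc (2 * q) (length proper) 1)) (ℕ.+-monoʳ-≤ (2 * q)
          (ℕ.≤-trans (ℕ.≤-reflexive (ℕ.+-comm (length proper) 1)) length-proper)))))
      (subst (_< P) p≡1+q p<P) (subst (λ x → (x ∸ 2) * (x ∸ 3) ≤ P) p≡1+q P-bound)
      where
      five≤ : ∀ q → suc (P + P) ≤ 2 * q + q → suc q < P → 5 ≤ q
      five≤ q 2P<3q q+1<P = ℕ.+-cancelˡ-≤ (q + q) 5 q (begin
        q + q + 5                           ≡⟨ regroup q ⟩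
        suc (suc (suc q) + suc (suc q))     ≤⟨ s≤s (ℕ.+-mono-≤ q+1<P q+1<P) ⟩
        suc (P + P)                         ≤⟨ 2P<3q ⟩
        2 * q + q                           ≡⟨ cong (λ x → q + x + q) (ℕ.+-identityʳ q) ⟩
        q + q + q                           ∎)
        where
        open ℕ.≤-Reasoning
        regroup : ∀ q → q + q + 5 ≡ suc (suc (suc q) + suc (suc q))
        regroup = ℕ-solve-∀
      arithmetic : ∀ q → suc (P + P) ≤ 2 * q + q → suc q < P → (suc q ∸ 2) * (suc q ∸ 3) ≤ P → ⊥
      -- With q = 5 + s the truncated subtractions are exact: p - 2 = 4 + s and p - 3 = 3 + s.
      arithmetic q 2P<3q q+1<P bound with ℕ.m≤n⇒∃[o]m+o≡n (five≤ q 2P<3q q+1<P)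
      ... | s , refl = ℕ.<-irrefl refl (begin-strict
          15 + 3 * s                                  <⟨ ℕ.m≤m+n (16 + 3 * s) (8 + 11 * s + 2 * (s * s)) ⟩
          16 + 3 * s + (8 + 11 * s + 2 * (s * s))     ≡⟨ expand s ⟩
          (4 + s) * (3 + s) + (4 + s) * (3 + s)       ≤⟨ ℕ.+-mono-≤ bound bound ⟩
          P + P                                       ≤⟨ ℕ.n≤1+n (P + P) ⟩
          suc (P + P)                                 ≤⟨ 2P<3q ⟩
          2 * (5 + s) + (5 + s)                       ≡⟨ collect s ⟩
          15 + 3 * s                                  ∎)
        where
        open ℕ.≤-Reasoning
        expand : ∀ s → 16 + 3 * s + (8 + 11 * s + 2 * (s * s)) ≡ (4 + s) * (3 + s) + (4 + s) * (3 + s)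
        expand = ℕ-solve-∀
        collect : ∀ s → 2 * (5 + s) + (5 + s) ≡ 15 + 3 * s
        collect = ℕ-solve-∀

    -- For k ≥ 1 already p^k divides the difference. For k = 0 a common divisor of A p and the
    -- difference has no factor taken from `p` and is not `A`, hence is a proper divisor of `A`.
    holes-≅-A-or-p : ∀ y y′ → Hole N y → Hole N y′ → ¬ y ≅ y′ [ A ] → ¬ y ≅ y′ [ p ] → ⊥
    holes-≅-A-or-p y y′ y∉ y′∉ A∤ p∤ with k ℕ.≟ 0
    ... | no  k≢0 = p∤ (∣-trans (subst (_∣ p ^ k) (ℕ.*-identityʳ p) (^-mono-∣ (ℕ.n≢0⇒n>0 k≢0))) (holes-≅-p^ y y′ y∉ y′∉))
    ... | yes k≡0 = small-k k≡0 (two-holes proper y y′ y∉ y′∉ λ d∣N d∣v →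
      let i , e , _ , e∣A , eq = ∣*^⇒ {A = A} (suc k) isPrime d∣N
          i≡0 = ℕ.n<1⇒n≡0 (p^∣⇒< {i} {e} {1} (subst (_∣ ℤ.∣ y ℤ.- y′ ∣) eq d∣v) (p∤ ∘ subst (_∣ ℤ.∣ y ℤ.- y′ ∣) (ℕ.*-identityʳ p)))
          d≡e = trans eq (trans (cong (λ i → p ^ i * e) i≡0) (ℕ.*-identityˡ e))
      in ∈-proper (subst (_∣ A) (sym d≡e) e∣A) d∣v A∤)

    A*p^1 : A * p ^ 1 ≡ A * p
    A*p^1 = cong (A *_) (ℕ.*-identityʳ p)

    few-p : FewNew A p
    few-p = subst (λ n → FewNew n p) (ℕ.*-identityʳ A) (few-new isPrime hasDivisors divisors-few 0)

    E : List Congruence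
    E = New A p C

    E∣ : ∀ {c} → c ∈ E → modulus c ∣ A * p × ¬ modulus c ∣ A
    E∣ = ∈-New⁻ {n = A} {p} {C}

    module Low = TwoHoles {n = A} {{base≢0}} isPrime E E∣

    child-hole : ∀ w → Hole A w → ∀ {y} → y ≅ w [ A ] × Uncovered E y → Hole (A * p) y
    child-hole w w∉ {y} (y≅w , y∉E) = uncovered-new {A} {C} {p} y
      (uncovered-resp {A} (Below A C) {w} {y} (proj₂ ∘ ∈-Below⁻ {n = A} {C = C}) (≅-sym {A} {y} {w} y≅w) w∉) y∉E

    -- Both points are holes mod A p and extend to holes mod `N` within their classes mod A p. If
    -- they differed mod `p` as well as mod `A`, these extensions would contradict `holes-≅-A-or-p`.
    children-≅-p : ∀ w w′ → Hole A w → Hole A w′ → ¬ w ≅ w′ [ A ] → ∀ y y′ →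
      y ≅ w [ A ] × Uncovered E y → y′ ≅ w′ [ A ] × Uncovered E y′ → y ≅ y′ [ p ]
    children-≅-p w w′ w∉ w′∉ w≇w′ y y′ h@(y≅w , _) h′@(y′≅w′ , _) with p ∣? ℤ.∣ y ℤ.- y′ ∣
    ... | yes y≅y′ = y≅y′
    ... | no  y≇y′ = ⊥-elim (holes-≅-A-or-p z z′ z∉ z′∉
        (λ z≅z′ → w≇w′ (chain A w y z w′ y′ z′ y≅w y′≅w′ (≅-weaken {y = z} {y} A∣ z≅y) (≅-weaken {y = z′} {y′} A∣ z′≅y′) z≅z′))
        (λ z≅z′ → y≇y′ (chain p y y z y′ y′ z′ (≅-refl {p} {y}) (≅-refl {p} {y′})
                         (≅-weaken {y = z} {y} p∣ z≅y) (≅-weaken {y = z′} {y′} p∣ z′≅y′) z≅z′)))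
      where
      chain : ∀ n w y z w′ y′ z′ → y ≅ w [ n ] → y′ ≅ w′ [ n ] → z ≅ y [ n ] → z′ ≅ y′ [ n ] → z ≅ z′ [ n ] → w ≅ w′ [ n ]
      chain n w y z w′ y′ z′ y≅w y′≅w′ z≅y z′≅y′ z≅z′ = ≅-trans {n} {w} {z} {w′}
        (≅-sym {n} {z} {w} (≅-trans {n} {z} {y} {w} z≅y y≅w))
        (≅-trans {n} {z} {z′} {w′} z≅z′ (≅-trans {n} {z′} {y′} {w′} z′≅y′ y′≅w′))
      A∣ : A ∣ A * p ^ 1
      A∣ = m∣m*n (p ^ 1)
      p∣ : p ∣ A * p ^ 1
      p∣ = subst (p ∣_) (sym A*p^1) (n∣m*n A)
      lift : ∀ w → Hole A w → ∀ y → y ≅ w [ A ] × Uncovered E y → ∃[ z ] z ≅ y [ A * p ^ 1 ] × Hole N z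
      lift w w∉ y h = let z , z≅y , z∉ = extend u 1 k y (subst (λ n → Hole n y) (sym A*p^1) (child-hole w w∉ {y} h)) in
        z , z≅y , subst (λ j → Hole (A * p ^ j) z) (ℕ.+-comm k 1) z∉
      z z′ : ℤ
      z  = proj₁ (lift w w∉ y h)
      z′ = proj₁ (lift w′ w′∉ y′ h′)
      z≅y : z ≅ y [ A * p ^ 1 ]
      z≅y = proj₁ (proj₂ (lift w w∉ y h))
      z′≅y′ : z′ ≅ y′ [ A * p ^ 1 ]
      z′≅y′ = proj₁ (proj₂ (lift w′ w′∉ y′ h′))
      z∉ : Hole N z
      z∉ = proj₂ (proj₂ (lift w w∉ y h))
      z′∉ : Hole N z′
      z′∉ = proj₂ (proj₂ (lift w′ w′∉ y′ h′))

    A⊥p^ : ∀ j → Coprime A (p ^ j)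
    A⊥p^ j = coprime-^ j isPrime (coprime isPrime ℕ.≤-refl)

    -- Two children of `w` agree mod `p` with one fixed child of `w′`, hence with each other, and
    -- they agree mod `A`, which is coprime to `p`.
    single-child : ∀ w w′ → Hole A w → Hole A w′ → ¬ w ≅ w′ [ A ] → length (Low.holes w) ≤ 1
    single-child w w′ w∉ w′∉ w≇w′ = short (Low.holes w) (Low.holes-distinct w) (Low.holes-sound w)
      where
      other : ∃[ y′ ] y′ ≅ w′ [ A ] × Uncovered E y′
      other = ∃-uncovered-child {A} {{base≢0}} isPrime E w′ E∣ (length-New {A} {p} {C} few-p u)
      y′ : ℤ
      y′ = proj₁ other
      short : ∀ ys → AllPairs (λ y z → ¬ y ≅ z [ A * p ]) ys → (∀ {y} → y ∈ ys → y ≅ w [ A ] × Uncovered E y) → length ys ≤ 1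
      short []          _ _ = z≤n
      short (_ ∷ [])    _ _ = s≤s z≤n
      short (x ∷ y ∷ _) ((x≇y ∷ _) ∷ _) sound = contradiction (coprime-*-∣ A⊥p x≅y-A x≅y-p) x≇y
        where
        A⊥p : Coprime A p
        A⊥p = subst (Coprime A) (ℕ.*-identityʳ p) (A⊥p^ 1)
        x≅y-A : x ≅ y [ A ]
        x≅y-A = ≅-trans {A} {x} {w} {y} (proj₁ (sound (here refl))) (≅-sym {A} {y} {w} (proj₁ (sound (there (here refl)))))
        x≅y-p : x ≅ y [ p ]
        x≅y-p = ≅-trans {p} {x} {y′} {y} (children-≅-p w w′ w∉ w′∉ w≇w′ x y′ (sound (here refl)) (proj₂ other))
          (≅-sym {p} {y} {y′} (children-≅-p w w′ w∉ w′∉ w≇w′ y y′ (sound (there (here refl))) (proj₂ other)))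

    -- Each class keeps at most one of its `p` children, so at least 2 q hits are needed from at
    -- most q new moduli. But p A hits only one of two classes that differ mod `A`, so fewer than 2
    -- q hits are available.
    holes-≅-A : ∀ w w′ → Hole A w → Hole A w′ → w ≅ w′ [ A ]
    holes-≅-A w w′ w∉ w′∉ with A ∣? ℤ.∣ w ℤ.- w′ ∣
    ... | yes w≅w′ = w≅w′
    ... | no  w≇w′ = contradiction (Low.count-holes w w′) (ℕ.<⇒≱ (begin-strict
        (length (Low.holes w) + length (Low.holes w′)) + (length E + length (Low.both w w′))
          ≤⟨ ℕ.+-mono-≤ (ℕ.+-mono-≤ (single-child w w′ w∉ w′∉ w≇w′) (single-child w′ w w′∉ w∉ (w≇w′ ∘ ≅-sym {A} {w′} {w})))
               (ℕ.+-monoˡ-≤ (length (Low.both w w′)) |E|≤q) ⟩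
        2 + (q + length (Low.both w w′))
          <⟨ ℕ.+-monoʳ-< 2 (ℕ.+-monoʳ-< q (ℕ.≤-<-trans both≤ length-proper)) ⟩
        2 + (q + q)
          ≡⟨ cong suc (ℕ.+-suc q q) ⟨
        suc q + suc q
          ≡⟨ cong₂ _+_ divisors-count divisors-count ⟩
        p + p ∎))
      where
      open ℕ.≤-Reasoning
      |E|≤q : length E ≤ q
      |E|≤q = ℕ.≤-pred (subst (length E <_) p≡1+q (length-New {A} {p} {C} few-p u))
      both⊆ : ∀ {m} → m ∈ map modulus (Low.both w w′) → m ∈ map (p *_) proper
      both⊆ m∈ =
        let c , c∈ , m≡ = ∈-map⁻ modulus m∈
            c∈E , c∣ = Low.both-∣ w w′ c∈
            ∣Ap , ∤A = E∣ c∈E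
            d , d∣A , c≡ = new-divisor₁ {n = A} isPrime ∣Ap ∤A
        in subst (_∈ map (p *_) proper) (sym (trans m≡ c≡)) (∈-map⁺ (p *_)
             (∈-proper d∣A (*-cancelˡ-∣ p (subst (_∣ p * ℤ.∣ w ℤ.- w′ ∣) c≡ c∣)) w≇w′))
      both≤ : length (Low.both w w′) ≤ length proper
      both≤ = subst₂ _≤_ (length-map modulus (Low.both w w′)) (length-map (p *_) proper)
        (length-⊆ (AllPairs.map⁺ (AllPairs.filter⁺ _ (AllPairs.map⁻ (new-moduli {C} {A} {p} u)))) both⊆)

    -- Agreement mod `A` is inherited from holes mod `A`. Agreement mod p^k is known only for holes
    -- mod `N`, so both are first extended by one more factor `p`.
    holes-≅ : ∀ w w′ → Hole (A * p ^ k) w → Hole (A * p ^ k) w′ → w ≅ w′ [ A * p ^ k ]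
    holes-≅ w w′ w∉ w′∉ = coprime-*-∣ (A⊥p^ k)
      (holes-≅-A w w′ (uncovered-below {A} {A * p ^ k} {C} (m∣m*n (p ^ k)) w w∉) (uncovered-below {A} {A * p ^ k} {C} (m∣m*n (p ^ k)) w′ w′∉))
      (let z , z≅w , z∉ = extend u k 1 w w∉ ; z′ , z′≅w′ , z′∉ = extend u k 1 w′ w′∉ in
        ≅-trans {p ^ k} {w} {z} {w′} (≅-sym {p ^ k} {z} {w} (≅-weaken {y = z} {w} (n∣m*n A) z≅w))
          (≅-trans {p ^ k} {z} {z′} {w′} (holes-≅-p^ z z′ z∉ z′∉) (≅-weaken {y = z′} {w′} (n∣m*n A) z′≅w′)))

  single-hole : ∃ (Single (A * p ^ k) (Below (A * p ^ k) C))
  single-hole = let z , z∉ = hole-*^ C u ≥2 k in z , λ y →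
    (λ y∉ → holes-≅ y z y∉ z∉) ,
    (λ y≅z → uncovered-resp {A * p ^ k} (Below (A * p ^ k) C) {z} {y} (proj₂ ∘ ∈-Below⁻ {n = A * p ^ k} {C = C})
      (≅-sym {A * p ^ k} {y} {z} y≅z) z∉)

-- The layers of the last two primes

Closed : ℕ → Region → Set
Closed n U = ∀ y z → y ≅ z [ n ] → U y → U z

join-∣ : ∀ n {p P v} .{{_ : NonZero n}} → Coprime p P → n * p ∣ v → n * P ∣ v → n * p * P ∣ v
join-∣ n {p} {P} {v} p⊥P (divides s eq) nP∣v = subst₂ _∣_ (sym (ℕ.*-assoc n p P)) (sym v≡)
  (*-monoʳ-∣ n (coprime-*-∣ p⊥P (n∣m*n s) (*-cancelˡ-∣ n (subst (n * P ∣_) v≡ nP∣v))))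
  where
  v≡ : v ≡ n * (s * p)
  v≡ = trans eq (trans (sym (ℕ.*-assoc s n p)) (trans (cong (_* p) (ℕ.*-comm s n)) (ℕ.*-assoc n s p)))

-- `n * p` and `n * P` share the factor `n`, so remaindering works only above a common class mod
-- `n`, here that of `z`. There a cell of either kind can be chosen freely, and each pair meets in
-- one cell mod n p P.
glue-cells : ∀ {p P u zs ws} z .{{_ : NonZero n}} → Coprime p P → u ℤ.* + p ≅ + 1 [ P ] →
  (∀ y → U₁ y → y ≅ z [ n ]) → (∀ y → U₂ y → y ≅ z [ n ]) → Closed (n * p) U₁ → Closed (n * P) U₂ →
  Cells (n * p) U₁ zs → Cells (n * P) U₂ ws →
  Cells (n * p * P) (λ y → U₁ y × U₂ y) (cartesianProductWith (glue p u) zs ws)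
glue-cells {n} {U₁} {U₂} {p} {P} {u} {zs} {ws} z p⊥P up≅1 U₁⊆ U₂⊆ closed₁ closed₂ cells₁ cells₂ = record
  { complete = λ {y} (y∈₁ , y∈₂) →
      let x , x∈ , y≅x = Cells.complete cells₁ {y} y∈₁ ; w , w∈ , y≅w = Cells.complete cells₂ {y} y∈₂ in
      glue p u x w , ∈-cartesianProductWith⁺ (glue p u) x∈ w∈ ,
      join-∣ n p⊥P (≅-trans {n * p} {y} {x} {glue p u x w} y≅x (≅-sym {n * p} {glue p u x w} {x} (left x∈ w∈)))
                   (≅-trans {n * P} {y} {w} {glue p u x w} y≅w (≅-sym {n * P} {glue p u x w} {w} (right x∈ w∈)))
  ; sound    = λ {y} y∈ → let x , w , x∈ , w∈ , eq = ∈-cartesianProductWith⁻ (glue p u) zs ws y∈ in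
      subst (λ y → U₁ y × U₂ y) (sym eq)
        ( closed₁ x (glue p u x w) (≅-sym {n * p} {glue p u x w} {x} (left x∈ w∈)) (Cells.sound cells₁ x∈)
        , closed₂ w (glue p u x w) (≅-sym {n * P} {glue p u x w} {w} (right x∈ w∈)) (Cells.sound cells₂ w∈))
  ; distinct = glued-distinct zs id (Cells.distinct cells₁)
  }
  where
  base : ∀ {x w} → x ∈ zs → w ∈ ws → x ≅ w [ n ]
  base {x} {w} x∈ w∈ = ≅-trans {n} {x} {z} {w} (U₁⊆ x (Cells.sound cells₁ x∈)) (≅-sym {n} {w} {z} (U₂⊆ w (Cells.sound cells₂ w∈)))
  left : ∀ {x w} → x ∈ zs → w ∈ ws → glue p u x w ≅ x [ n * p ]
  left {x} {w} x∈ w∈ = glue-left {n} {p} {u} {x} {w} (base x∈ w∈)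
  right : ∀ {x w} → x ∈ zs → w ∈ ws → glue p u x w ≅ w [ n * P ]
  right {x} {w} x∈ w∈ = glue-right {n} {p} {P} {u} {x} {w} up≅1 (base x∈ w∈)
  nP∣ : n * P ∣ n * p * P
  nP∣ = subst (n * P ∣_) (trans (ℕ.*-assoc n P p) (trans (cong (n *_) (ℕ.*-comm P p)) (sym (ℕ.*-assoc n p P)))) (m∣m*n p)
  glued-distinct : ∀ xs → (∀ {x} → x ∈ xs → x ∈ zs) → AllPairs (λ y z → ¬ y ≅ z [ n * p ]) xs →
    AllPairs (λ y z → ¬ y ≅ z [ n * p * P ]) (cartesianProductWith (glue p u) xs ws)
  glued-distinct []       _  _         = []
  glued-distinct (x ∷ xs) ⊆zs (x≇ ∷ rs) = AllPairs.++⁺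
    (AllPairs.map⁺ (AllPairs-map∈ (λ {w} {w′} w∈ w′∈ w≇w′ eq → w≇w′
      (≅-trans {n * P} {w} {glue p u x w} {w′} (≅-sym {n * P} {glue p u x w} {w} (right (⊆zs (here refl)) w∈))
        (≅-trans {n * P} {glue p u x w} {glue p u x w′} {w′} (∣-trans nP∣ eq) (right (⊆zs (here refl)) w′∈))))
      (Cells.distinct cells₂)))
    (glued-distinct xs (⊆zs ∘ there) rs)
    (All.tabulate λ {y} y∈ → All.tabulate λ {y′} y′∈ y≅y′ →
      let w , w∈ , eq = ∈-map⁻ (glue p u x) y∈
          x′ , w′ , x′∈ , w′∈ , eq′ = ∈-cartesianProductWith⁻ (glue p u) xs ws y′∈
      in All.lookup x≇ x′∈ (≅-trans {n * p} {x} {y} {x′}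
           (≅-sym {n * p} {y} {x} (subst (_≅ x [ n * p ]) (sym eq) (left (⊆zs (here refl)) w∈)))
           (≅-trans {n * p} {y} {y′} {x′} (∣-trans (m∣m*n P) y≅y′)
             (subst (_≅ x′ [ n * p ]) (sym eq′) (left (⊆zs (there x′∈)) w′∈)))))

-- Membership in `Γ M` without the order and size of the moduli, which are properties of `M` and are
-- restored at the end.
FullCover : List ℕ → List Congruence → Set
FullCover M C = map modulus C ≡ M × Normalised C × (∀ z → Covered C z)

-- A covering is cut into the congruences with modulus dividing n (which leave one class mod n), those in the last p-layer,
-- those in the first P-layer over n, and the remaining ones, which have to fill one cell mod n p P each.
module Counting {n p P W : ℕ} .{{n≢0 : NonZero n}} (p-prime : Prime p) (P-prime : Prime P) (p⊥P : Coprime p P) (count : Count n W)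
  {M : List ℕ} (uM : Unique M) (M∣ : ∀ {m} → m ∈ M → 2 ≤ m × m ∣ n * p * P)
  (single-hole : ∀ C → FullCover M C → ∃ (Single n (Below n C)))
  (irredundant : ∀ C → FullCover M C → Fits (λ _ → ⊤) C)
  (C₁ : List Congruence) (full₁ : FullCover M C₁) where

  private instance
    p≢0 : NonZero p
    p≢0 = prime⇒nonZero p-prime
    P≢0 : NonZero P
    P≢0 = prime⇒nonZero P-prime

  private
    _∣n? : Decidable (_∣ n)
    m ∣n? = m ∣? n
    _∣np? : Decidable (_∣ n * p)
    m ∣np? = m ∣? n * p
    _∣nP? : Decidable (_∣ n * P)
    m ∣nP? = m ∣? n * P

    module _ {X : Set} (f : X → ℕ) where
      -- Defined for any list labelled by numbers, so that the same cut applies to congruences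
      -- through `modulus` and to moduli through `id`. The sizes of the parts therefore depend on
      -- `M` only.
      above rest part₀ partₚ part-P part-pP : List X → List X
      above   = filter (¬? ∘ _∣n? ∘ f)
      rest    = filter (¬? ∘ _∣np? ∘ f) ∘ above
      part₀   = filter (_∣n? ∘ f)
      partₚ   = filter (_∣np? ∘ f) ∘ above
      part-P  = filter (_∣nP? ∘ f) ∘ rest
      part-pP = filter (¬? ∘ _∣nP? ∘ f) ∘ rest

      ∈-part₀ : ∀ {x} xs → x ∈ part₀ xs → x ∈ xs × f x ∣ n
      ∈-part₀ xs = ∈-filter⁻ (_∣n? ∘ f)
      ∈-rest : ∀ {x} xs → x ∈ rest xs → x ∈ xs × ¬ f x ∣ n * p
      ∈-rest xs x∈ = let x∈′ , ∤np = ∈-filter⁻ (¬? ∘ _∣np? ∘ f) x∈ in proj₁ (∈-filter⁻ (¬? ∘ _∣n? ∘ f) x∈′) , ∤np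
      ∈-partₚ : ∀ {x} xs → x ∈ partₚ xs → x ∈ xs × f x ∣ n * p × ¬ f x ∣ n
      ∈-partₚ xs x∈ = let x∈′ , ∣np = ∈-filter⁻ (_∣np? ∘ f) {xs = above xs} x∈ ; x∈xs , ∤n = ∈-filter⁻ (¬? ∘ _∣n? ∘ f) x∈′ in
        x∈xs , ∣np , ∤n
      ∈-part-P : ∀ {x} xs → x ∈ part-P xs → x ∈ xs × f x ∣ n * P × ¬ f x ∣ n * p
      ∈-part-P xs x∈ = let x∈′ , ∣nP = ∈-filter⁻ (_∣nP? ∘ f) {xs = rest xs} x∈ ; x∈xs , ∤np = ∈-rest xs x∈′ in x∈xs , ∣nP , ∤np
      ∈-part-pP : ∀ {x} xs → x ∈ part-pP xs → x ∈ xs × ¬ f x ∣ n * p × ¬ f x ∣ n * P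
      ∈-part-pP xs x∈ = let x∈′ , ∤nP = ∈-filter⁻ (¬? ∘ _∣nP? ∘ f) {xs = rest xs} x∈ ; x∈xs , ∤np = ∈-rest xs x∈′ in x∈xs , ∤np , ∤nP

      parts : List X → List X
      parts xs = ((part-pP xs ++ part-P xs) ++ partₚ xs) ++ part₀ xs

      parts-↭ : ∀ xs → parts xs ↭ xs
      parts-↭ xs = ↭-trans (++⁺ʳ (part₀ xs) (↭-trans (++⁺ʳ (partₚ xs) (filter-↭ (_∣nP? ∘ f) (rest xs))) (filter-↭ (_∣np? ∘ f) (above xs))))
        (filter-↭ (_∣n? ∘ f) xs)

    module _ (C : List Congruence) where
      map-above : map modulus (above modulus C) ≡ above id (map modulus C)
      map-above = map-filter (¬? ∘ _∣n?) modulus C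
      map-rest : map modulus (rest modulus C) ≡ rest id (map modulus C)
      map-rest = trans (map-filter (¬? ∘ _∣np?) modulus (above modulus C)) (cong (filter (¬? ∘ _∣np?)) map-above)
      map-part₀ : map modulus (part₀ modulus C) ≡ part₀ id (map modulus C)
      map-part₀ = map-filter _∣n? modulus C
      map-partₚ : map modulus (partₚ modulus C) ≡ partₚ id (map modulus C)
      map-partₚ = trans (map-filter _∣np? modulus (above modulus C)) (cong (filter _∣np?) map-above)
      map-part-P : map modulus (part-P modulus C) ≡ part-P id (map modulus C)
      map-part-P = trans (map-filter _∣nP? modulus (rest modulus C)) (cong (filter _∣nP?) map-rest)
      map-part-pP : map modulus (part-pP modulus C) ≡ part-pP id (map modulus C)
      map-part-pP = trans (map-filter (¬? ∘ _∣nP?) modulus (rest modulus C)) (cong (filter (¬? ∘ _∣nP?)) map-rest)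

  M₀ V Q R : List ℕ
  M₀ = part₀ id M
  V  = partₚ id M
  Q  = part-P id M
  R  = part-pP id M

  private
    M₀∣ : ∀ {m} → m ∈ M₀ → 2 ≤ m × m ∣ n
    M₀∣ m∈ = let m∈M , ∣n = ∈-part₀ id M m∈ in proj₁ (M∣ m∈M) , ∣n
    V∣ : ∀ {m} → m ∈ V → 0 < m × m ∣ n * p × ¬ m ∣ n
    V∣ m∈ = let m∈M , ∣np , ∤n = ∈-partₚ id M m∈ in ℕ.<⇒≤ (proj₁ (M∣ m∈M)) , ∣np , ∤n
    Q∣ : ∀ {m} → m ∈ Q → 0 < m × m ∣ n * P × ¬ m ∣ n
    Q∣ m∈ = let m∈M , ∣nP , ∤np = ∈-part-P id M m∈ in ℕ.<⇒≤ (proj₁ (M∣ m∈M)) , ∣nP , λ ∣n → ∤np (∣m⇒∣m*n p ∣n)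
    R∣ : ∀ {m} → m ∈ R → 0 < m × m ∣ n * p * P × ¬ m ∣ n * p × ¬ m ∣ n * P
    R∣ m∈ = let m∈M , ∤np , ∤nP = ∈-part-pP id M m∈ in ℕ.<⇒≤ (proj₁ (M∣ m∈M)) , proj₂ (M∣ m∈M) , ∤np , ∤nP

    uAbove : Unique (above id M)
    uAbove = Unique.filter⁺ (¬? ∘ _∣n?) uM
    uRest : Unique (rest id M)
    uRest = Unique.filter⁺ (¬? ∘ _∣np?) uAbove
    uV : Unique V
    uV = Unique.filter⁺ _∣np? uAbove
    uQ : Unique Q
    uQ = Unique.filter⁺ _∣nP? uRest
    uR : Unique R
    uR = Unique.filter⁺ (¬? ∘ _∣nP?) uRest

    -- The condition on `C` occurs twice so that the region is an intersection of the form treated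
    -- by `glue-cells`: its cells are pairs of a free cell mod n p and a free cell mod n P.
    Open : (C D E : List Congruence) → Region
    Open C D E y = (Uncovered C ∖ D) y × (Uncovered C ∖ E) y

    Lower : List Congruence × List Congruence → Set
    Lower (C , D) = OneHole n M₀ C × Assignment (Uncovered C) V D

    Middle : (List Congruence × List Congruence) × List Congruence → Set
    Middle ((C , D) , E) = Lower (C , D) × Assignment (Uncovered C) Q E

    Whole : ((List Congruence × List Congruence) × List Congruence) × List Congruence → Set
    Whole (((C , D) , E) , F) = Middle ((C , D) , E) × Assignment (Open C D E) R F

    module Hole {C} (one : OneHole n M₀ C) where
      z : ℤ
      z = proj₁ (proj₂ (proj₂ one))
      single : Single n C z
      single = proj₂ (proj₂ (proj₂ one))
      C∣n : ∀ {c} → c ∈ C → modulus c ∣ n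
      C∣n c∈ = proj₂ (M₀∣ (∈-moduli (proj₁ one) c∈))
      cells : ∀ a .{{_ : NonZero a}} → Cells (n * a) (Uncovered C) (children z n a)
      cells a = cells-resp (λ y → proj₂ (single y)) (λ y → proj₁ (single y)) (children-cells {n} {a} z)
      separates : ∀ {a m} → Prime a → m ∣ n * a → ¬ m ∣ n → Separates (n * a) (Uncovered C) m
      separates a-prime = separates-prime {n = n} a-prime z (λ y → proj₁ (single y))
      V-separates : ∀ {m} → m ∈ V → 0 < m × Separates (n * p) (Uncovered C) m
      V-separates m∈ = let 0<m , ∣ₘ , ∤ₘ = V∣ m∈ in 0<m , separates p-prime ∣ₘ ∤ₘ
      Q-separates : ∀ {m} → m ∈ Q → 0 < m × Separates (n * P) (Uncovered C) m
      Q-separates m∈ = let 0<m , ∣ₘ , ∤ₘ = Q∣ m∈ in 0<m , separates P-prime ∣ₘ ∤ₘ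

    module Layer {a} .{{_ : NonZero a}} {C} (one : OneHole n M₀ C) {T} (uT : Unique T)
      (T-separates : ∀ {m} → m ∈ T → 0 < m × Separates (n * a) (Uncovered C) m)
      {D} (assigned : Assignment (Uncovered C) T D) where
      open Hole one
      reps : List ℤ
      reps = survivors D (children z n a)
      sep : Separating (n * a) (Uncovered C) D
      sep c∈ = proj₂ (T-separates (∈-moduli (proj₁ assigned) c∈))
      left-cells : Cells (n * a) (Uncovered C ∖ D) reps
      left-cells = survivors-cells D (cells a) (proj₁ ∘ sep)
      size : length reps + length T ≡ a
      size = trans (cong (λ t → length reps + t) (trans (cong length (sym (proj₁ assigned))) (length-map modulus D)))
        (trans (length-survivors (Unique.map⁻ (subst Unique (sym (proj₁ assigned)) uT)) sep (cells a) (proj₂ (proj₂ assigned)))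
          (length-children z n a))
      closed : Closed (n * a) (Uncovered C ∖ D)
      closed y w y≅w (y∉C , y∉D) =
        uncovered-resp {n} C {y} {w} C∣n (≅-weaken {y = y} {w} (m∣m*n a) y≅w) y∉C ,
        uncovered-resp {n * a} D {y} {w} (proj₁ ∘ sep) y≅w y∉D

    module Open′ {C D E} (one : OneHole n M₀ C) (assignedD : Assignment (Uncovered C) V D) (assignedE : Assignment (Uncovered C) Q E) where
      open Hole one
      module D = Layer {p} one uV V-separates assignedD
      module E = Layer {P} one uQ Q-separates assignedE
      reps : List ℤ
      reps = cartesianProductWith (glue p (proj₁ (inverse p⊥P))) D.reps E.reps
      open-cells : Cells (n * p * P) (Open C D E) reps
      open-cells = glue-cells {n} {u = proj₁ (inverse p⊥P)} z p⊥P (proj₂ (inverse p⊥P)) (λ y → proj₁ (single y) ∘ proj₁) (λ y → proj₁ (single y) ∘ proj₁)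
        D.closed E.closed D.left-cells E.left-cells
      size : length reps ≡ (p ∸ length V) * (P ∸ length Q)
      size = trans (length-cartesianProductWith (glue p (proj₁ (inverse p⊥P))) D.reps E.reps)
        (cong₂ _*_ (shrink (length D.reps) (length V) D.size) (shrink (length E.reps) (length Q) E.size))
        where
        shrink : ∀ s t {a} → s + t ≡ a → s ≡ a ∸ t
        shrink s t refl = sym (ℕ.m+n∸n≡m s t)
      R-separates : ∀ {m} → m ∈ R → 0 < m × Separates (n * p * P) (Open C D E) m
      R-separates m∈ = let 0<m , ∣ₘ , ∤np , ∤nP = R∣ m∈ in 0<m , ∣ₘ , λ x y ((x∉ , _) , _) ((y∉ , _) , _) x≅y →
        separate₂-∣ p-prime P-prime p⊥P ∣ₘ ∤np ∤nP
          (≅-trans {n} {x} {z} {y} (proj₁ (single x) x∉) (≅-sym {n} {y} {z} (proj₁ (single y) y∉))) x≅y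

      module _ {F} (assignedF : Assignment (Open C D E) R F) where
        sep : Separating (n * p * P) (Open C D E) F
        sep c∈ = proj₂ (R-separates (∈-moduli (proj₁ assignedF) c∈))
        final-cells : Cells (n * p * P) (Open C D E ∖ F) (survivors F reps)
        final-cells = survivors-cells F open-cells (proj₁ ∘ sep)
        final-size : length (survivors F reps) + length R ≡ (p ∸ length V) * (P ∸ length Q)
        final-size = trans (cong (λ t → length (survivors F reps) + t) (trans (cong length (sym (proj₁ assignedF))) (length-map modulus F)))
          (trans (length-survivors (Unique.map⁻ (subst Unique (sym (proj₁ assignedF)) uR)) sep open-cells (proj₂ (proj₂ assignedF))) size)

    cut : List Congruence → ((List Congruence × List Congruence) × List Congruence) × List Congruence
    cut C = ((part₀ modulus C , partₚ modulus C) , part-P modulus C) , part-pP modulus C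

    paste : ((List Congruence × List Congruence) × List Congruence) × List Congruence → List Congruence
    paste (((C , D) , E) , F) = ((F ++ E) ++ D) ++ C

    Whole⇒moduli : ∀ {t} → Whole t → map modulus (paste t) ≡ parts id M
    Whole⇒moduli {((C , D) , E) , F} ((((eqC , _) , (eqD , _)) , (eqE , _)) , (eqF , _)) =
      append (append (append eqF eqE) eqD) eqC
      where
      append : ∀ {B B′ T T′} → map modulus B ≡ T → map modulus B′ ≡ T′ → map modulus (B ++ B′) ≡ T ++ T′
      append {B} {B′} refl refl = map-++ modulus B B′

    uParts : Unique (parts id M)
    uParts = Unique-resp-↭ (↭-sym (parts-↭ id M)) uM

    -- A private point of a congruence in the whole covering avoids each earlier part, because the
    -- moduli there satisfy a divisibility that its own modulus fails. So it is a private point in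
    -- the region left to its part.
    cut-whole : ∀ {C} → FullCover M C → Whole (cut C)
    cut-whole {C} full@(refl , norm , covers) =
      (( (map-part₀ C , All.filter⁺ _ norm , single-hole C full)
       , (map-partₚ C , All.filter⁺ _ (All.filter⁺ _ norm) , λ c c∈ →
           let c∈C , _ , ∤n = ∈-partₚ modulus C c∈ ; y , _ , y∈c , only = irredundant C full c c∈C in
           y , avoid-C₀ y only ∤n , y∈c , λ c′ c′∈ → only c′ (proj₁ (∈-partₚ modulus C c′∈))))
      , (map-part-P C , All.filter⁺ _ (All.filter⁺ _ (All.filter⁺ _ norm)) , λ c c∈ →
           let c∈C , _ , ∤np = ∈-part-P modulus C c∈ ; y , _ , y∈c , only = irredundant C full c c∈C in
           y , avoid-C₀ y only (∤np ∘ ∣m⇒∣m*n p) , y∈c , λ c′ c′∈ → only c′ (proj₁ (∈-part-P modulus C c′∈))))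
      , (map-part-pP C , All.filter⁺ _ (All.filter⁺ _ (All.filter⁺ _ norm)) , λ c c∈ →
           let c∈C , ∤np , ∤nP = ∈-part-pP modulus C c∈ ; y , _ , y∈c , only = irredundant C full c c∈C in
           y , ( (avoid-C₀ y only (∤np ∘ ∣m⇒∣m*n p)
                 , avoid (_∣ n * p) y (λ c′∈ → let c′∈C , ∣np , _ = ∈-partₚ modulus C c′∈ in c′∈C , ∣np) only ∤np)
               , (avoid-C₀ y only (∤np ∘ ∣m⇒∣m*n p)
                 , avoid (_∣ n * P) y (λ c′∈ → let c′∈C , ∣nP , _ = ∈-part-P modulus C c′∈ in c′∈C , ∣nP) only ∤nP)) ,
           y∈c , λ c′ c′∈ → only c′ (proj₁ (∈-part-pP modulus C c′∈)))
      where
      avoid : (T : ℕ → Set) → ∀ y {B c} → (∀ {c′} → c′ ∈ B → c′ ∈ C × T (modulus c′)) →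
        (∀ c′ → c′ ∈ C → y Satisfies c′ → c′ ≡ c) → ¬ T (modulus c) → Uncovered B y
      avoid T y B⊆ only ¬T y∈B = let c′ , c′∈ , y∈c′ = find y∈B ; c′∈C , t = B⊆ c′∈ in
        ¬T (subst (T ∘ modulus) (only c′ c′∈C y∈c′) t)
      avoid-C₀ : ∀ y {c} → (∀ c′ → c′ ∈ C → y Satisfies c′ → c′ ≡ c) → ¬ modulus c ∣ n → Uncovered (part₀ modulus C) y
      avoid-C₀ y = avoid (_∣ n) y (∈-part₀ modulus C)

    -- In the covering `C₁` no open cell survives the last part. Both sides depend on `M` only, so
    -- the equality also holds for every other choice of the first three parts.
    cells≡ : (p ∸ length V) * (P ∸ length Q) ≡ length R
    cells≡ = trans (sym (final-size (proj₂ whole₁))) (cong (_+ length R)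
      (no-survivors (survivors (part-pP modulus C₁) reps) (Cells.sound (final-cells (proj₂ whole₁)))))
      where
      whole₁ : Whole (cut C₁)
      whole₁ = cut-whole full₁
      open Open′ (proj₁ (proj₁ (proj₁ whole₁))) (proj₂ (proj₁ (proj₁ whole₁))) (proj₂ (proj₁ whole₁))
      no-survivors : (ws : List ℤ) →
        (∀ {w} → w ∈ ws → (Open (part₀ modulus C₁) (partₚ modulus C₁) (part-P modulus C₁) ∖ part-pP modulus C₁) w) → length ws ≡ 0
      no-survivors []      _     = refl
      no-survivors (w ∷ _) sound = let ((w∉C , w∉D) , (_ , w∉E)) , w∉F = sound (here refl) in
        contradiction (proj₂ (proj₂ full₁) w) (uncovered-⊆ (∈-resp-↭ (↭-sym (parts-↭ modulus C₁))) w
          (uncovered-++ ((part-pP modulus C₁ ++ part-P modulus C₁) ++ partₚ modulus C₁) w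
            (uncovered-++ (part-pP modulus C₁ ++ part-P modulus C₁) w (uncovered-++ (part-pP modulus C₁) w w∉F w∉E) w∉D) w∉C))

    -- By `cells≡` the last part has as many congruences as there are open cells; since they fit,
    -- none of these cells stays free.
    paste-full : ∀ {t} → Whole t → ∃[ B ] FullCover M B × paste t ↭ B
    paste-full {((C , D) , E) , F} whole@(((C-one , D-fits) , E-fits) , F-fits) =
      let B , M≡ , ↭B = ↭-map-inv modulus {paste (((C , D) , E) , F)}
                          (subst (_↭ M) (sym (Whole⇒moduli whole)) (parts-↭ id M))
      in B , (sym M≡ , All-resp-↭ ↭B (All.++⁺ (All.++⁺ (All.++⁺ (norm F-fits) (norm E-fits)) (norm D-fits)) (proj₁ (proj₂ C-one)))
             , λ y → decidable-stable (covered? B y) λ y∉B → no-survivor y (uncovered-⊆ (∈-resp-↭ ↭B) y y∉B)) , ↭B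
      where
      open Open′ C-one D-fits E-fits
      norm : ∀ {U T D} → Assignment U T D → Normalised D
      norm = proj₁ ∘ proj₂
      empty : {A : Set} (xs : List A) → length xs ≡ 0 → ∀ {x} → ¬ x ∈ xs
      empty [] _ ()
      no-survivor : ∀ y → Uncovered (((F ++ E) ++ D) ++ C) y → ⊥
      no-survivor y y∉ =
        let FE⊆ : ∀ {c} → c ∈ F ++ E → c ∈ ((F ++ E) ++ D) ++ C
            FE⊆ = ∈-++⁺ˡ ∘ ∈-++⁺ˡ
            y∉C = uncovered-⊆ (∈-++⁺ʳ ((F ++ E) ++ D)) y y∉
            y∉D = uncovered-⊆ (∈-++⁺ˡ ∘ ∈-++⁺ʳ (F ++ E)) y y∉
            y∉E = uncovered-⊆ (FE⊆ ∘ ∈-++⁺ʳ F) y y∉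
            y∉F = uncovered-⊆ (FE⊆ ∘ ∈-++⁺ˡ) y y∉
            w , w∈ , _ = Cells.complete (final-cells F-fits) {y} (((y∉C , y∉D) , (y∉C , y∉E)) , y∉F)
        in empty (survivors F reps) (ℕ.+-cancelʳ-≡ (length R) (length (survivors F reps)) 0 (trans (final-size F-fits) cells≡)) w∈

    paste-injective : ∀ {t t′ B} → Whole t → Whole t′ → paste t ↭ B → paste t′ ↭ B → t ≡ t′
    paste-injective {((C , D) , E) , F} {((C′ , D′) , E′) , F′}
      w@((((eqC , _) , (eqD , _)) , (eqE , _)) , (eqF , _)) w′@((((eqC′ , _) , (eqD′ , _)) , (eqE′ , _)) , (eqF′ , _)) ↭B ↭B′ =
      let eq : paste (((C , D) , E) , F) ≡ paste (((C′ , D′) , E′) , F′)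
          eq = ↭-same-moduli (trans (Whole⇒moduli w) (sym (Whole⇒moduli w′)))
                 (subst Unique (sym (Whole⇒moduli w)) uParts) (↭-trans ↭B (↭-sym ↭B′))
          |F| = length-moduli F F′ (trans eqF (sym eqF′))
          |E| = length-moduli E E′ (trans eqE (sym eqE′))
          |D| = length-moduli D D′ (trans eqD (sym eqD′))
          |FE| = trans (length-++ F) (trans (cong₂ _+_ |F| |E|) (sym (length-++ F′)))
          |FED| = trans (length-++ (F ++ E)) (trans (cong₂ _+_ |FE| |D|) (sym (length-++ (F′ ++ E′))))
          eqFED , C≡ = ++-injective ((F ++ E) ++ D) ((F′ ++ E′) ++ D′) |FED| eq
          eqFE , D≡ = ++-injective (F ++ E) (F′ ++ E′) |FE| eqFED
          F≡ , E≡ = ++-injective F F′ |F| eqFE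
      in cong₂ _,_ (cong₂ _,_ (cong₂ _,_ C≡ D≡) E≡) F≡

    lower-card : HasCardinality Lower (W * fall p (length V))
    lower-card = card-× (count M₀ (Unique.filter⁺ _∣n? uM) M₀∣ (_ , proj₁ (proj₁ (proj₁ (cut-whole full₁))))) λ {C} one →
      let open Hole one in subst (λ a → HasCardinality (Assignment (Uncovered C) V) (fall a (length V))) (length-children z n p)
        (card-assignments (cells p) V uV V-separates)

    middle-card : HasCardinality Middle (W * fall p (length V) * fall P (length Q))
    middle-card = card-× lower-card λ { {C , D} (one , _) →
      let open Hole one in subst (λ a → HasCardinality (Assignment (Uncovered C) Q) (fall a (length Q))) (length-children z n P)
        (card-assignments (cells P) Q uQ Q-separates) }

    whole-card : HasCardinality Whole (W * fall p (length V) * fall P (length Q) * length R !)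
    whole-card = card-× middle-card λ { {(C , D) , E} ((one , D-fits) , E-fits) →
      let open Open′ one D-fits E-fits in subst (HasCardinality (Assignment (Open C D E) R))
        (trans (cong (λ s → fall s (length R)) (trans size cells≡)) (fall-full (length R)))
        (card-assignments open-cells R uR R-separates) }

  private
    uniform : ∀ {T : Congruence → Set} (T? : Decidable T) {S : Congruence → Set} (S? : Decidable S) {xs T-moduli} →
      filter S? C₁ ≡ xs → map modulus xs ≡ T-moduli →
      (∀ {c} → c ∈ C₁ → T c → S c) → (∀ {c} → c ∈ C₁ → S c → T c) → length (filter T? C₁) ≡ length T-moduli
    uniform T? S? {xs} refl refl f g = trans (cong length (filter-cong∈ T? S? f g)) (sym (length-map modulus xs))

    above-≡ : filter (λ c → (¬? (modulus c ∣n?)) ×-dec ¬? (modulus c ∣np?)) C₁ ≡ rest modulus C₁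
    above-≡ = sym (filter-filter (¬? ∘ _∣n? ∘ modulus) (¬? ∘ _∣np? ∘ modulus) C₁)

  -- `T` is kept abstract so that the description by exact prime powers can be inserted; equivalence
  -- on the members of `C₁` suffices.
  length-V : ∀ {T : Congruence → Set} (T? : Decidable T) →
    (∀ {c} → c ∈ C₁ → T c → ¬ modulus c ∣ n × modulus c ∣ n * p) →
    (∀ {c} → c ∈ C₁ → ¬ modulus c ∣ n × modulus c ∣ n * p → T c) → length (filter T? C₁) ≡ length V
  length-V T? = uniform T? (λ c → (¬? (modulus c ∣n?)) ×-dec (modulus c ∣np?))
    (sym (filter-filter (¬? ∘ _∣n? ∘ modulus) (_∣np? ∘ modulus) C₁))
    (trans (map-partₚ C₁) (cong (partₚ id) (proj₁ full₁)))

  length-Q : ∀ {T : Congruence → Set} (T? : Decidable T) →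
    (∀ {c} → c ∈ C₁ → T c → (¬ modulus c ∣ n × ¬ modulus c ∣ n * p) × modulus c ∣ n * P) →
    (∀ {c} → c ∈ C₁ → (¬ modulus c ∣ n × ¬ modulus c ∣ n * p) × modulus c ∣ n * P → T c) →
    length (filter T? C₁) ≡ length Q
  length-Q T? = uniform T? (λ c → ((¬? (modulus c ∣n?)) ×-dec ¬? (modulus c ∣np?)) ×-dec (modulus c ∣nP?))
    (trans (sym (filter-filter (λ c → (¬? (modulus c ∣n?)) ×-dec ¬? (modulus c ∣np?)) (_∣nP? ∘ modulus) C₁))
           (cong (filter (_∣nP? ∘ modulus)) above-≡))
    (trans (map-part-P C₁) (cong (part-P id) (proj₁ full₁)))

  length-R : ∀ {T : Congruence → Set} (T? : Decidable T) →
    (∀ {c} → c ∈ C₁ → T c → (¬ modulus c ∣ n × ¬ modulus c ∣ n * p) × ¬ modulus c ∣ n * P) →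
    (∀ {c} → c ∈ C₁ → (¬ modulus c ∣ n × ¬ modulus c ∣ n * p) × ¬ modulus c ∣ n * P → T c) →
    length (filter T? C₁) ≡ length R
  length-R T? = uniform T? (λ c → ((¬? (modulus c ∣n?)) ×-dec ¬? (modulus c ∣np?)) ×-dec ¬? (modulus c ∣nP?))
    (trans (sym (filter-filter (λ c → (¬? (modulus c ∣n?)) ×-dec ¬? (modulus c ∣np?)) (¬? ∘ _∣nP? ∘ modulus) C₁))
           (cong (filter (¬? ∘ _∣nP? ∘ modulus)) above-≡))
    (trans (map-part-pP C₁) (cong (part-pP id) (proj₁ full₁)))

  part-sizes : length V ≤ p × length Q ≤ P
  part-sizes = bound D.size , bound E.size
    where
    whole₁ : Whole (cut C₁)
    whole₁ = cut-whole full₁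
    open Open′ (proj₁ (proj₁ (proj₁ whole₁))) (proj₂ (proj₁ (proj₁ whole₁))) (proj₂ (proj₁ whole₁))
    bound : ∀ {s t a} → s + t ≡ a → t ≤ a
    bound {s} refl = ℕ.m≤n+m _ s

  full-card : HasCardinality (FullCover M) (W * fall p (length V) * fall P (length Q) * length R !)
  full-card = card-bijection (λ t B → paste t ↭ B) paste-full
    (λ {B} full → cut B , cut-whole full , parts-↭ modulus B)
    paste-injective
    (λ (eqB , _) (eqB′ , _) ↭B ↭B′ →
      ↭-same-moduli (trans eqB (sym eqB′)) (subst Unique (sym eqB) uM) (↭-trans (↭-sym ↭B) ↭B′))
    whole-card

-- Minimal coverings

∈⇒∣lcms : ∀ {m M} → m ∈ M → m ∣ lcms M
∈⇒∣lcms {M = m ∷ M} (here refl) = m∣lcm[m,n] m (lcms M)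
∈⇒∣lcms {M = m ∷ M} (there m∈)  = ∣-trans (∈⇒∣lcms m∈) (n∣lcm[m,n] m (lcms M))

isCovering-filter : ∀ {C} {T : Congruence → Set} (T? : Decidable T) → IsCovering C →
  (∀ z → Covered (filter T? C) z) → IsCovering (filter T? C)
isCovering-filter T? isCovering covers = record
  { increasing = Linked.map⁺ (Linked.filter⁺ T? ℕ.<-trans (Linked.map⁻ increasing))
  ; moduli≥2   = All.filter⁺ T? moduli≥2
  ; normalised = All.filter⁺ T? normalised
  ; covers     = covers
  }
  where open IsCovering isCovering using (increasing; moduli≥2; normalised)

without : Congruence → List Congruence → List Congruence
without c = filter (λ c′ → ¬? (≡-dec ℕ._≟_ ℕ._≟_ c′ c))

∈-without⁺ : ∀ {c c′ C} → c′ ∈ C → c′ ≢ c → c′ ∈ without c C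
∈-without⁺ {c} = ∈-filter⁺ (λ c′ → ¬? (≡-dec ℕ._≟_ ℕ._≟_ c′ c))

-- If the other congruences covered the period 0, ..., L - 1, they would form a smaller covering.
-- Searching this finite period yields an explicit integer covered by `c` alone.
minimal⇒fits : ∀ {L C} .{{_ : NonZero L}} → (∀ {c} → c ∈ C → modulus c ∣ L) → IsMinimalCovering C → Fits (λ _ → ⊤) C
minimal⇒fits {L} {C} C∣L (isCovering , minimal) c c∈ with any? (λ j → ¬? (covered? (without c C) (+ j))) (upTo L)
... | yes found =
  let j , _ , j∉ = find found
      only : ∀ c′ → c′ ∈ C → (+ j) Satisfies c′ → c′ ≡ c
      only c′ c′∈ j∈c′ = decidable-stable (≡-dec ℕ._≟_ ℕ._≟_ c′ c) λ c′≢c →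
        j∉ (Any.map (λ { refl → j∈c′ }) (∈-without⁺ c′∈ c′≢c))
      c′ , c′∈ , j∈c′ = find (IsCovering.covers isCovering (+ j))
  in + j , tt , subst ((+ j) Satisfies_) (only c′ c′∈ j∈c′) j∈c′ , only
... | no none = ⊥-elim (minimal (without c C) (proj₁ ∘ ∈-filter⁻ _)
  (λ eq → proj₂ (∈-filter⁻ (λ c′ → ¬? (≡-dec ℕ._≟_ ℕ._≟_ c′ c)) {xs = C} (subst (c ∈_) (sym eq) c∈)) refl)
  (isCovering-filter _ isCovering λ z → decidable-stable (covered? (without c C) z) λ z∉ →
    none (Any.map (λ { refl → uncovered-resp {L} (without c C) {z} {+ (z ℤ.%ℕ L)} (C∣L ∘ proj₁ ∘ ∈-filter⁻ _) (≅-% z L) z∉ })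
      (∈-upTo⁺ (ℤ.n%ℕd<d z L)))))

-- Exact prime powers in a modulus and divisibility by n, n p and n P.

module Layers {A p P k : ℕ} (p-prime : Prime p) (P-prime : Prime P) (p≢P : p ≢ P) (p∤A : ¬ p ∣ A) (P∤A : ¬ P ∣ A)
  {m : ℕ} (m∣L : m ∣ A * p ^ suc k * P) where

  private
    base : ℕ
    base = A * p ^ k
    reorder : ∀ A x P → A * x * P ≡ A * P * x
    reorder = ℕ-solve-∀
    p∤AP : ¬ p ∣ A * P
    p∤AP = prime∤* p-prime p∤A (prime∤prime p-prime P-prime p≢P)
    P∤np : ¬ P ∣ base * p
    P∤np = prime∤* P-prime (prime∤* P-prime P∤A (prime∤^ k P-prime (prime∤prime P-prime p-prime (p≢P ∘ sym))))
      (prime∤prime P-prime p-prime (p≢P ∘ sym))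
    p^suc∤ : ∀ j → ¬ p ^ suc j ∣ A * p ^ j * P
    p^suc∤ j d = p∤AP (*-cancelˡ-∣ (p ^ j) {{ℕ.m^n≢0 p j {{prime⇒nonZero p-prime}}}}
      (subst₂ _∣_ (ℕ.*-comm p (p ^ j)) (trans (reorder A (p ^ j) P) (ℕ.*-comm (A * P) (p ^ j))) d))
    m∣npP : m ∣ base * p * P
    m∣npP = subst (λ x → m ∣ x * P) (sym (*^-suc A p k)) m∣L
    p⊥P : Coprime p P
    p⊥P = ∤⇒coprime p-prime (prime∤prime p-prime P-prime p≢P)

  P∤⇐ : m ∣ base * p → ¬ P ∣ m
  P∤⇐ m∣np P∣m = P∤np (∣-trans P∣m m∣np)

  P∤⇒ : ¬ P ∣ m → m ∣ base * p
  P∤⇒ P∤m = Coprime.coprime-divisor (Coprime.sym (∤⇒coprime P-prime P∤m)) (subst (m ∣_) (ℕ.*-comm (base * p) P) m∣npP)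

  p^∤⇐ : m ∣ base * P → ¬ p ^ suc k ∣ m
  p^∤⇐ m∣nP p^∣m = p^suc∤ k (∣-trans p^∣m m∣nP)

  p^∤⇒ : ¬ p ^ suc k ∣ m → m ∣ base * P
  p^∤⇒ p^∤m with i , d , i≤ , d∣ , eq ← ∣*^⇒ {A = A * P} (suc k) p-prime (subst (m ∣_) (reorder A (p ^ suc k) P) m∣L)
    with ℕ.m≤n⇒m<n∨m≡n i≤
  ... | inj₂ refl      = contradiction (subst (p ^ i ∣_) (sym eq) (m∣m*n d)) p^∤m
  ... | inj₁ (s≤s i≤k) = subst₂ _∣_ (sym eq) (trans (ℕ.*-comm (p ^ k) (A * P)) (sym (reorder A (p ^ k) P)))
    (*-pres-∣ (^-mono-∣ i≤k) d∣)

  p^∣⇒∥ : p ^ suc k ∣ m → p ^ suc k ∥ m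
  p^∣⇒∥ p^∣m = p^∣m , λ p^∣m′ → p^suc∤ (suc k) (∣-trans p^∣m′ m∣L)

  P∥⇒P∣ : P ^ 1 ∥ m → P ∣ m
  P∥⇒P∣ (P^1∣m , _) = subst (_∣ m) (ℕ.*-identityʳ P) P^1∣m

  P∣⇒P∥ : P ∣ m → P ^ 1 ∥ m
  P∣⇒P∥ P∣m = subst (_∣ m) (sym (ℕ.*-identityʳ P)) P∣m , λ P²∣m →
    P∤np (*-cancelˡ-∣ P {{prime⇒nonZero P-prime}} (subst₂ _∣_ (cong (P *_) (ℕ.*-identityʳ P)) (ℕ.*-comm (base * p) P) (∣-trans P²∣m m∣npP)))

  ∣n : m ∣ base * p → m ∣ base * P → m ∣ base
  ∣n = ∣*-coprime p⊥P

  ∣n⇒∣np : m ∣ base → m ∣ base * p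
  ∣n⇒∣np = ∣m⇒∣m*n p

  V⇒ : p ^ suc k ∥ m × ¬ P ∣ m → ¬ m ∣ base × m ∣ base * p
  V⇒ ((p^∣m , _) , P∤m) = (λ m∣n → p^∤⇐ (∣m⇒∣m*n P m∣n) p^∣m) , P∤⇒ P∤m

  V⇐ : ¬ m ∣ base × m ∣ base * p → p ^ suc k ∥ m × ¬ P ∣ m
  V⇐ (m∤n , m∣np) = p^∣⇒∥ (decidable-stable (p ^ suc k ∣? m) λ p^∤m → m∤n (∣n m∣np (p^∤⇒ p^∤m))) , P∤⇐ m∣np

  Q⇒ : P ^ 1 ∥ m × ¬ p ^ suc k ∣ m → (¬ m ∣ base × ¬ m ∣ base * p) × m ∣ base * P
  Q⇒ (P∥m , p^∤m) = ((λ m∣n → P∤⇐ (∣n⇒∣np m∣n) (P∥⇒P∣ P∥m)) , λ m∣np → P∤⇐ m∣np (P∥⇒P∣ P∥m)) , p^∤⇒ p^∤m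

  Q⇐ : (¬ m ∣ base × ¬ m ∣ base * p) × m ∣ base * P → P ^ 1 ∥ m × ¬ p ^ suc k ∣ m
  Q⇐ ((_ , m∤np) , m∣nP) = P∣⇒P∥ (decidable-stable (P ∣? m) (m∤np ∘ P∤⇒)) , p^∤⇐ m∣nP

  R⇒ : P ^ 1 ∥ m × p ^ suc k ∣ m → (¬ m ∣ base × ¬ m ∣ base * p) × ¬ m ∣ base * P
  R⇒ (P∥m , p^∣m) = ((λ m∣n → P∤⇐ (∣n⇒∣np m∣n) (P∥⇒P∣ P∥m)) , λ m∣np → P∤⇐ m∣np (P∥⇒P∣ P∥m)) , λ m∣nP → p^∤⇐ m∣nP p^∣m

  R⇐ : (¬ m ∣ base × ¬ m ∣ base * p) × ¬ m ∣ base * P → P ^ 1 ∥ m × p ^ suc k ∣ m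
  R⇐ ((_ , m∤np) , m∤nP) = P∣⇒P∥ (decidable-stable (P ∣? m) (m∤np ∘ P∤⇒)) , decidable-stable (p ^ suc k ∣? m) (m∤nP ∘ p^∤⇒)

-- The theorem with A for the first r − 2 prime powers of L and W for the corresponding product of (p_i !)^α_i.
count-coverings : ∀ {A p W P α Π} → Stage A p W → Π ≡ W * (p !) ^ α * (P !) → Prime P → p < P → 0 < α → α * (p ∸ 1) < P → (p ∸ 2) * (p ∸ 3) ≤ P →
  ∀ M → IsMinimalModuli M → (∀ {m} → m ∈ M → m ∣ A * p ^ α * P) → ∀ C → Γ M C →
  let Cₚ = filter (λ c → exactPower? P 1 (modulus c)) C
      Cₚ₋₁ = filter (λ c → exactPower? p α (modulus c) ×-dec ¬? (P ∣? modulus c)) C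
      Q = filter (λ c → ¬? ((p ^ α) ∣? modulus c)) Cₚ
  in length Cₚ₋₁ ≤ p × length Q ≤ P × ∃[ N ] HasCardinality (Γ M) N ×
    N * ((p ∸ length Cₚ₋₁) ! * (P ∸ length Q) !) ≡ (length Cₚ ∸ length Q) ! * Π
count-coverings {A} {p} {W} {P} {suc k} {Π} stage Π≡ P-prime p<P _ k-bound P-bound M (_ , minimal) M∣L C₁ (isCovering₁ , eq₁) =
  subst (_≤ p) (sym V≡) (proj₁ part-sizes) , subst (_≤ P) (sym Q≡) (proj₂ part-sizes) ,
  -- The factors count the one-hole systems below n = A p^k, the placements of `V` mod `p` and of
  -- `Q` mod `P`, and the bijective fillings of the open cells by `R`.
  W * (p !) ^ k * fall p (length V) * fall P (length Q) * length R ! ,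
  card-cong to from full-card , formula
  where
  open Stage stage
  base : ℕ
  base = A * p ^ k
  L≡ : A * p ^ suc k * P ≡ base * p * P
  L≡ = cong (_* P) (sym (*^-suc A p k))
  P∤A : ¬ P ∣ A
  P∤A = coprime P-prime (ℕ.<⇒≤ p<P)
  p∤A : ¬ p ∣ A
  p∤A = coprime isPrime ℕ.≤-refl
  p≢P : p ≢ P
  p≢P = ℕ.<⇒≢ p<P
  instance
    n≢0 : NonZero base
    n≢0 = base-*^≢0 k
    P≢0 : NonZero P
    P≢0 = prime⇒nonZero P-prime
    L≢0 : NonZero (A * p ^ suc k * P)
    L≢0 = ℕ.m*n≢0 (A * p ^ suc k) P {{base-*^≢0 (suc k)}}
  increasing : Linked _<_ M
  increasing = subst (Linked _<_) eq₁ (IsCovering.increasing isCovering₁)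
  moduli≥2 : All (2 ≤_) M
  moduli≥2 = subst (All (2 ≤_)) eq₁ (All.map⁺ (IsCovering.moduli≥2 isCovering₁))
  uM : Unique M
  uM = AllPairs.map ℕ.<⇒≢ (Linked.Linked⇒AllPairs ℕ.<-trans increasing)
  to : ∀ {C} → FullCover M C → Γ M C
  to {C} (eq , norm , covers) = record
    { increasing = subst (Linked _<_) (sym eq) increasing
    ; moduli≥2   = All.map⁻ (subst (All (2 ≤_)) (sym eq) moduli≥2)
    ; normalised = norm
    ; covers     = covers
    } , eq
  from : ∀ {C} → Γ M C → FullCover M C
  from (isCovering , eq) = eq , IsCovering.normalised isCovering , IsCovering.covers isCovering
  C∣L : ∀ {C} → map modulus C ≡ M → ∀ {c} → c ∈ C → modulus c ∣ A * p ^ suc k * P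
  C∣L eq c∈ = M∣L (∈-moduli eq c∈)
  open Counting {base} {p} {P} isPrime P-prime (∤⇒coprime isPrime (prime∤prime isPrime P-prime p≢P)) (count-*^ k) uM
    (λ {m} m∈ → All.lookup moduli≥2 m∈ , subst (m ∣_) L≡ (M∣L m∈))
    (λ C (eq , norm , covers) → Structure.single-hole {k = k} stage P-prime p<P k-bound P-bound
      (subst Unique (sym eq) uM) (λ c∈ → All.lookup moduli≥2 (∈-moduli eq c∈)) (C∣L eq) covers)
    (λ C full → minimal⇒fits (C∣L (proj₁ full)) (minimal C (to full)))
    C₁ (from (isCovering₁ , eq₁))
  module L {c} (c∈ : c ∈ C₁) = Layers {A} {p} {P} {k} isPrime P-prime p≢P p∤A P∤A (C∣L eq₁ c∈)
  exact : Decidable (λ c → P ^ 1 ∥ modulus c)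
  exact c = exactPower? P 1 (modulus c)
  high : Decidable (λ c → p ^ suc k ∣ modulus c)
  high c = (p ^ suc k) ∣? modulus c
  Cₚ : List Congruence
  Cₚ = filter exact C₁
  V≡ : length (filter (λ c → exactPower? p (suc k) (modulus c) ×-dec ¬? (P ∣? modulus c)) C₁) ≡ length V
  V≡ = length-V _ (λ c∈ → L.V⇒ c∈) (λ c∈ → L.V⇐ c∈)
  Q≡ : length (filter (¬? ∘ high) Cₚ) ≡ length Q
  Q≡ = trans (cong length (filter-filter exact (¬? ∘ high) C₁)) (length-Q _ (λ c∈ → L.Q⇒ c∈) (λ c∈ → L.Q⇐ c∈))
  R≡ : length Cₚ ∸ length (filter (¬? ∘ high) Cₚ) ≡ length R
  R≡ = trans (cong (_∸ length (filter (¬? ∘ high) Cₚ)) (trans (sym (↭-length (filter-↭ high Cₚ))) (length-++ (filter (¬? ∘ high) Cₚ))))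
    (trans (ℕ.m+n∸m≡n (length (filter (¬? ∘ high) Cₚ)) _)
      (trans (cong length (filter-filter exact high C₁)) (length-R _ (λ c∈ → L.R⇒ c∈) (λ c∈ → L.R⇐ c∈))))
  formula : W * (p !) ^ k * fall p (length V) * fall P (length Q) * length R ! *
    ((p ∸ length (filter (λ c → exactPower? p (suc k) (modulus c) ×-dec ¬? (P ∣? modulus c)) C₁)) ! * (P ∸ length (filter (¬? ∘ high) Cₚ)) !)
    ≡ (length Cₚ ∸ length (filter (¬? ∘ high) Cₚ)) ! * Π
  formula = begin
    W * (p !) ^ k * fall p (length V) * fall P (length Q) * length R ! *
      ((p ∸ length (filter (λ c → exactPower? p (suc k) (modulus c) ×-dec ¬? (P ∣? modulus c)) C₁)) ! * (P ∸ length (filter (¬? ∘ high) Cₚ)) !)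
      ≡⟨ cong₂ (λ v t → W * (p !) ^ k * fall p (length V) * fall P (length Q) * length R ! * ((p ∸ v) ! * (P ∸ t) !)) V≡ Q≡ ⟩
    W * (p !) ^ k * fall p (length V) * fall P (length Q) * length R ! * ((p ∸ length V) ! * (P ∸ length Q) !)
      ≡⟨ regroup (W * (p !) ^ k) (fall p (length V)) (fall P (length Q)) (length R !) ((p ∸ length V) !) ((P ∸ length Q) !) ⟩
    length R ! * (W * (p !) ^ k * (fall p (length V) * (p ∸ length V) !) * (fall P (length Q) * (P ∸ length Q) !))
      ≡⟨ cong₂ (λ x y → length R ! * (W * (p !) ^ k * x * y)) (fall-! (proj₁ part-sizes)) (fall-! (proj₂ part-sizes)) ⟩
    length R ! * (W * (p !) ^ k * p ! * P !)
      ≡⟨ cong₂ (λ r x → r ! * x) (sym R≡) (trans (cong (_* P !) (*^-suc W (p !) k)) (sym Π≡)) ⟩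
    (length Cₚ ∸ length (filter (¬? ∘ high) Cₚ)) ! * Π ∎
    where
    open ≡-Reasoning
    regroup : ∀ w v q r v′ q′ → w * v * q * r * (v′ * q′) ≡ r * (w * (v * v′) * (q * q′))
    regroup = ℕ-solve-∀

-- The recursion drops the first prime, moving its power into the accumulator `A` and the power of
-- its factorial into `W`. It stops when two primes are left, as the last two follow different
-- rules.
stages : ∀ k (p α : Fin (2 + k) → ℕ) {A W} → (∀ i → Prime (p i)) → (∀ (i : Fin (suc k)) → p (inject₁ i) < p (suc i)) →
  (∀ (t : Fin k) → suc (suc (α (inject₁ (inject₁ t))) * (p (inject₁ (inject₁ t)) ∸ 1)) ≡ p (inject₁ (suc t))) →
  Stage A (p zero) W →
  let penult = inject₁ (fromℕ k) ; last = fromℕ (suc k) in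
  ∃[ A′ ] ∃[ W′ ] Stage A′ (p penult) W′ ×
    A * ∏ (λ i → p i ^ α i) ≡ A′ * p penult ^ α penult * p last ^ α last ×
    W * ∏ (λ i → (p i !) ^ α i) ≡ W′ * (p penult !) ^ α penult * (p last !) ^ α last
stages zero p α {A} {W} _ _ _ stage = A , W , stage ,
  pair A (p zero ^ α zero) (p (suc zero) ^ α (suc zero)) , pair W ((p zero !) ^ α zero) ((p (suc zero) !) ^ α (suc zero))
  where
  pair : ∀ a x y → a * (x * (y * 1)) ≡ a * x * y
  pair a x y = trans (sym (ℕ.*-assoc a x (y * 1))) (cong (λ z → a * x * z) (ℕ.*-identityʳ y))
stages (suc k) p α {A} {W} p-prime p-increasing p-step stage =
  let A′ , W′ , stage′ , eqA , eqW = stages k (p ∘ suc) (α ∘ suc) (p-prime ∘ suc) (p-increasing ∘ suc) (p-step ∘ suc)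
        (stage-next (α zero) stage (p-prime (suc zero)) (p-increasing zero) (p-step zero))
  in A′ , W′ , stage′ , trans (sym (ℕ.*-assoc A (p zero ^ α zero) _)) eqA , trans (sym (ℕ.*-assoc W ((p zero !) ^ α zero) _)) eqW

-- A prime `b` has b - 1 > 0, so the exact quotient is at least 1 and the truncated `∸ 1` in the
-- exponent loses nothing.
step-exponent : ∀ a {b} .{{_ : NonZero (a ∸ 1)}} → Prime b → (a ∸ 1) ∣ (b ∸ 1) →
  suc (suc ((b ∸ 1) / (a ∸ 1) ∸ 1) * (a ∸ 1)) ≡ b
step-exponent a {zero} b-prime _ = ⊥-elim (¬prime[0] b-prime)
step-exponent a {suc zero} b-prime _ = ⊥-elim (¬prime[1] b-prime)
step-exponent a {suc (suc b)} _ (divides (suc r) eq) = cong suc (trans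
  (cong (λ x → suc (x ∸ 1) * (a ∸ 1)) (trans (cong (_/ (a ∸ 1)) eq) (m*n/n≡m (suc r) (a ∸ 1)))) (sym eq))

theorem3 :
    ∀ {L : ℕ} (L∈𝓛 : 𝓛 L) → let open 𝓛 L∈𝓛 in
    ∀ (M : List ℕ) → IsMinimalModuli M → lcms M ≡ L →
    ∀ (C : List Congruence) → Γ M C →
    let Cpᵣ = filter (λ c → exactPower? pᵣ 1 (modulus c)) C
        Cpᵣ₋₁ = filter (λ c → exactPower? pᵣ₋₁ αᵣ₋₁ (modulus c) ×-dec ¬? (pᵣ ∣? modulus c)) C
        Q = filter (λ c → ¬? ((pᵣ₋₁ ^ αᵣ₋₁) ∣? modulus c)) Cpᵣ
    in
    length Cpᵣ₋₁ ≤ pᵣ₋₁ × length Q ≤ pᵣ ×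
    ∃[ N ] HasCardinality (Γ M) N ×
      N * ((pᵣ₋₁ ∸ length Cpᵣ₋₁) ! * (pᵣ ∸ length Q) !)
        ≡ (length Cpᵣ ∸ length Q) ! * ∏ (λ i → (p i !) ^ α i)
theorem3 {L} L∈𝓛 M minimal lcm≡L C C∈Γ =
  let A , W , stage , A≡ , W≡ = stages k p α p-prime p-increasing
        (λ t → trans (cong (λ x → suc (suc x * (p (inject₁ (inject₁ t)) ∸ 1))) (α-init t))
          (step-exponent (p (inject₁ (inject₁ t))) {{prime⇒nonZero-pred (p-prime (inject₁ (inject₁ t)))}} (p-prime (inject₁ (suc t))) (p-step t)))
        (subst (λ x → Stage 1 x 1) (sym p-first) stage-first)
      M∣ : ∀ {m} → m ∈ M → m ∣ A * pᵣ₋₁ ^ αᵣ₋₁ * pᵣ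
      M∣ {m} m∈ = subst (m ∣_) (trans lcm≡L (trans L≡∏ (trans (sym (ℕ.*-identityˡ _)) (trans A≡
        (cong (A * pᵣ₋₁ ^ αᵣ₋₁ *_) (last-exponent pᵣ)))))) (∈⇒∣lcms m∈)
      Π≡ : ∏ (λ i → (p i !) ^ α i) ≡ W * (pᵣ₋₁ !) ^ αᵣ₋₁ * (pᵣ !)
      Π≡ = trans (sym (ℕ.*-identityˡ _)) (trans W≡ (cong (W * (pᵣ₋₁ !) ^ αᵣ₋₁ *_) (last-exponent (pᵣ !))))
  in count-coverings stage Π≡ (p-prime (fromℕ (suc k))) pᵣ₋₁<pᵣ α-positive α-bound p-last M minimal M∣ C C∈Γ
  where
  open 𝓛 L∈𝓛
  last-exponent : ∀ x → x ^ α (fromℕ (suc k)) ≡ x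
  last-exponent x = trans (cong (x ^_) α-last) (ℕ.*-identityʳ x)
  pᵣ₋₁<pᵣ : pᵣ₋₁ < pᵣ
  pᵣ₋₁<pᵣ = p-increasing (fromℕ k)
  instance
    pred≢0 : NonZero (pᵣ₋₁ ∸ 1)
    pred≢0 = prime⇒nonZero-pred (p-prime penult)
    pᵣ≢0 : NonZero pᵣ
    pᵣ≢0 = prime⇒nonZero (p-prime (fromℕ (suc k)))
  α-positive : 0 < αᵣ₋₁
  α-positive = subst (0 <_) (sym α-penult) (m≥n⇒m/n>0 (ℕ.∸-monoˡ-≤ 1 (ℕ.<⇒≤ pᵣ₋₁<pᵣ)))
  α-bound : αᵣ₋₁ * (pᵣ₋₁ ∸ 1) < pᵣ
  α-bound = ℕ.≤-<-trans (subst (λ x → x * (pᵣ₋₁ ∸ 1) ≤ pᵣ ∸ 1) (sym α-penult) (m/n*n≤m (pᵣ ∸ 1) (pᵣ₋₁ ∸ 1)))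
    (ℕ.≤-reflexive (ℕ.suc-pred pᵣ))
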